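{- Let $T$ be a thick tree with loops with vertex set $V$ and sink $s\in V$, let $V_0=V\setminus\{s\}$, and let $(G,\oplus)$, $G\subset \mathbb{Z}_{\ge 0}^{V_0}$, be its sandpile group (the group of recurrent configurations). Then: (i) $G=\{\mathbf u\in\mathbb{Z}_{\ge 0}^{V_0} : \deg(j)>u_j\ge \deg(j)-e_{j,p(j)} \text{ for all } j\in V_0\}$. (ii) The map $\phi: G\to\prod_{j\in V_0}\mathbb{Z}/e_{j,p(j)}\mathbb{Z}$ whose $j$-th component is $$\phi(\mathbf u)_j=\sum_{i\succeq j}u_i \pmod{e_{j,p(j)}}$$ is a group isomorphism. In particular, the abstract group structure of the sandpile group does not depend on which vertex of $T$ is chosen to be the sink. (iii) The inverse map $\phi^{ -1}$ may be expressed recursively as follows: for every $\mathbf v\in\prod_{j\in V_0}\mathbb{Z}/e_{j,p(j)}\mathbb{Z}$ and every $j\in V_0$, $$\phi^{ -1}(\mathbf v)_j=\begin{cases} \tilde v_j, & \text{if } j \text{ is a leaf},\\ f_j\Bigl(\tilde v_j-\sum_{i\succ j}\phi^{ -1}(\mathbf v)_i\Bigr), & \text{otherwise},\end{cases}$$ where $\tilde v_j\in\{0,1,\dots,e_{j,p(j)}-1\}$ is the standard representative of $v_j\in \mathbb{Z}/e_{j,p(j)}\mathbb{Z}$, and, for any $j\in V_0$, $f_j:\mathbb{Z}\to\{\deg(j)-e_{j,p(j)},\dots,\deg(j)-1\}$ is the map uniquely determined by $f_j(m)\equiv m\pmod{e_{j,p(j)}}$.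
   Context: Graphs are finite, connected, undirected, with multiple edges and loops allowed. For vertices $i,j$, $e_{i,j}$ is the number of edges with endpoint set $\{i,j\}$ (so $e_{i,i}$ is the number of loops at $i$), and $\deg(i)=\sum_{j\in V}e_{i,j}$, so each loop is counted once. A distinguished vertex $s\in V$ is called the sink; $V_0=V\setminus\{s\}$. Thick tree with loops: a graph $T$ such that the simple graph $T'$ obtained by deleting all loops and reducing all nonzero edge multiplicities to $1$ is a tree. A leaf is a vertex $i\ne s$ of degree $1$ in $T'$. For $i,j\in V$, write $i\succeq j$ if $j$ lies on the unique path in $T'$ from $i$ to $s$ (endpoints included), and $i\succ j$ if moreover $i\ne j$. For $j\in V_0$, the parent $p(j)$ is the neighbour of $j$ in $T'$ lying on the path from $j$ to $s$ (i.e. $p(j)$ is adjacent to $j$ and $j\succ p(j)$). Sandpile model: a configuration is a vector $\mathbf u\in\mathbb{Z}_{\ge0}^{V_0}$. A vertex $i\in V_0$ is stable for $\mathbf u$ if $u_i<\deg(i)$, otherwise unstable; $\mathbf u$ is stable if all vertices of $V_0$ are. Toppling an unstable vertex $i$ replaces $u_i$ by $u_i-\deg(i)+e_{i,i}$ and $u_j$ by $u_j+e_{i,j}$ for each $j\in V_0$, $j\ne i$. Repeatedly toppling unstable vertices leads, in finitely many steps, to a stable configuration that is independent of the choices, denoted $\sigma(\mathbf u)$ (the stabilization). Put $\mathbf u\oplus\mathbf v=\sigma(\mathbf u+\mathbf v)$. A configuration $\mathbf u$ is recurrent if for every configuration $\mathbf v$ there is a configuration $\mathbf w$ with $\mathbf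 v\oplus\mathbf w=\mathbf u$. The set $G$ of recurrent configurations is an abelian group under $\oplus$ (known), called the sandpile group.
   Formalization: In (iii) the first case is claimed only for leaves without loops; a leaf carrying loops falls under the second case (with f_j), because for such a leaf the stated formula fails, e.g. V={s,a}, e_{a,s}=e_{a,a}=1, where G={1} but the representative is 0. -}

module Defs where

open import Algebra.Bundles using (AbelianGroup)
open import Algebra.Morphism.Structures using (module GroupMorphisms)
import Algebra.Properties.Semiring.Sum
open import Data.Bool.Base using (if_then_else_)
open import Data.Fin.Base using (Fin; punchIn)
open import Data.Fin.Properties using (_≟_; any?; punchInᵢ≢i)
open import Data.Integer.Base as ℤ using (ℤ)
open import Data.Integer.Divisibility.Signed
  using (_∣_; divides; ∣m∣n⇒∣m+n; ∣m⇒∣-m; ∣⇒∣ᵤ)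
import Data.Integer.Properties as ℤ
open import Data.Integer.DivMod using (_%ℕ_; _/ℕ_; n%ℕd<d; a≡a%ℕn+[a/ℕn]*n)
open import Data.Integer.Tactic.RingSolver using (solve-∀)
open import Data.List.Base using (List; []; _∷_; length)
open import Data.List.Membership.Propositional using (_∈_; _∉_)
open import Data.List.Relation.Binary.Subset.Propositional using (_⊆_)
open import Data.List.Relation.Unary.All using ([]; _∷_)
open import Data.List.Relation.Unary.All.Properties using (¬Any⇒All¬; All¬⇒¬Any)
open import Data.List.Relation.Unary.AllPairs using ([]; _∷_)
open import Data.List.Relation.Unary.Any using (here; there)
open import Data.List.Relation.Unary.Unique.Propositional using (Unique)
open import Data.Nat.Base
import Data.Nat.Divisibility as ℕ using (_∣_; ∣⇒≤)
open import Data.Nat.Induction using (<-wellFounded)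
open import Data.Nat.Properties hiding (_≟_)
open import Data.Product.Base using (Σ-syntax; ∃; ∃-syntax; _×_; _,_; proj₁; proj₂)
open import Data.Sum.Base using (_⊎_; inj₁; inj₂)
open import Function.Base using (_∘_)
open import Induction.WellFounded using (Acc; acc)
open import Level using (0ℓ)
open import Relation.Binary.Construct.Closure.ReflexiveTransitive
  using (Star; ε; _◅_; _◅◅_; gmap)
open import Relation.Binary.PropositionalEquality
open import Relation.Nullary.Decidable using (Dec; yes; no; does; _×-dec_; _⊎-dec_; ¬?)
open import Relation.Nullary.Negation using (¬_; contradiction)

open Algebra.Properties.Semiring.Sum +-*-semiring
  using (sum; sum-cong-≗; sum-remove; ∑-distrib-+; *-distribʳ-sum; sum-replicate-zero) public

import Data.List.Membership.DecPropositional as DecMembership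

record Multigraph (n : ℕ) : Set where
  field
    e     : Fin n → Fin n → ℕ
    e-sym : ∀ i j → e i j ≡ e j i

  -- A loop contributes 1, not 2.
  deg : Fin n → ℕ
  deg i = sum (e i)

  Adj : Fin n → Fin n → Set
  Adj i j = 0 < e i j

  Adj-sym : ∀ {i j} → Adj i j → Adj j i
  Adj-sym {i} {j} = subst (0 <_) (e-sym i j)

module _ {n : ℕ} (G : Multigraph n) where

  open Multigraph G

  Walk : Fin n → Fin n → Set
  Walk = Star Adj

  Connected : Set
  Connected = ∀ i j → Walk i j

vertices : {n : ℕ} {R : Fin n → Fin n → Set} {i j : Fin n} → Star R i j → List (Fin n)
vertices (ε {i})       = i ∷ []
vertices (_◅_ {i} _ w) = i ∷ vertices w

record Path {n : ℕ} (G : Multigraph n) (i j : Fin n) : Set where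
  constructor mkPath
  field
    walk     : Walk G i j
    distinct : Unique (vertices walk)

open Path public

record Cycle {n : ℕ} (G : Multigraph n) : Set where
  field
    {first last} : Fin n
    path         : Path G first last
    long         : 3 ≤ length (vertices (walk path))
    closing      : Multigraph.Adj G last first

-- `Cycle` ignores loops and multiple edges, so this is the usual notion
-- only for simple graphs; it is applied to `simplify G`.
IsTree : {n : ℕ} → Multigraph n → Set
IsTree G = Connected G × ¬ Cycle G

simplify : {n : ℕ} → Multigraph n → Multigraph n
simplify {n} G = record { e = e′ ; e-sym = e′-sym }
  where
  open Multigraph G

  e′ : Fin n → Fin n → ℕ
  e′ i j = if does (i ≟ j) then 0 else 1 ⊓ e i j

  e′-sym : ∀ i j → e′ i j ≡ e′ j i
  e′-sym i j with i ≟ j | j ≟ i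
  ... | yes _   | yes _   = refl
  ... | yes i≡j | no  j≢i = contradiction (sym i≡j) j≢i
  ... | no  i≢j | yes j≡i = contradiction (sym j≡i) i≢j
  ... | no  _   | no  _   = cong (1 ⊓_) (e-sym i j)

simplify-Adj : ∀ {n} (G : Multigraph n) {i j} →
               Multigraph.Adj (simplify G) i j → Multigraph.Adj G i j
simplify-Adj G {i} {j} a with i ≟ j
... | no _ = ≤-trans a (m⊓n≤n 1 _)

record ThickTree (n : ℕ) : Set where
  field
    graph  : Multigraph n
    isTree : IsTree (simplify graph)

  connected : Connected graph
  connected i j = gmap (λ v → v) (simplify-Adj graph) (proj₁ isTree i j)

module Paths {n : ℕ} (G : Multigraph n) where

  open Multigraph G
  open DecMembership (_≟_ {n}) using (_∈?_)

  start∈ : ∀ {i j} (w : Walk G i j) → i ∈ vertices w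
  start∈ ε       = here refl
  start∈ (_ ◅ _) = here refl

  end∈ : ∀ {i j} (w : Walk G i j) → j ∈ vertices w
  end∈ ε       = here refl
  end∈ (_ ◅ w) = there (end∈ w)

  suffix : ∀ {i j k} (w : Walk G i j) → Unique (vertices w) → k ∈ vertices w →
           Σ[ p ∈ Path G k j ] vertices (walk p) ⊆ vertices w
  suffix ε       u       (here refl) = mkPath ε u , λ z → z
  suffix (x ◅ w) u       (here refl) = mkPath (x ◅ w) u , λ z → z
  suffix (x ◅ w) (_ ∷ u) (there k∈)  with suffix w u k∈
  ... | p , p⊆w = p , there ∘ p⊆w

  walk⇒path : ∀ {i j} (w : Walk G i j) →
              Σ[ p ∈ Path G i j ] vertices (walk p) ⊆ vertices w
  walk⇒path ε = mkPath ε ([] ∷ []) , λ z → z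
  walk⇒path {i} (x ◅ w) with walk⇒path w
  ... | p , p⊆w with i ∈? vertices (walk p)
  ...   | yes i∈p = let q , q⊆p = suffix (walk p) (distinct p) i∈p
                    in q , there ∘ p⊆w ∘ q⊆p
  ...   | no  i∉p = mkPath (x ◅ walk p) (¬Any⇒All¬ _ i∉p ∷ distinct p)
                  , λ { (here z) → here z ; (there z) → there (p⊆w z) }

  ∈-◅◅ : ∀ {i j k v} (w : Walk G i j) (w′ : Walk G j k) →
         v ∈ vertices (w ◅◅ w′) → v ∈ vertices w ⊎ v ∈ vertices w′
  ∈-◅◅ ε       w′ v∈        = inj₂ v∈
  ∈-◅◅ (_ ◅ w) w′ (here z)  = inj₁ (here z)
  ∈-◅◅ (_ ◅ w) w′ (there z) with ∈-◅◅ w w′ z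
  ... | inj₁ l = inj₁ (there l)
  ... | inj₂ r = inj₂ r

  back : ∀ {i j} → Walk G i j → Walk G j i
  back ε       = ε
  back (x ◅ w) = back w ◅◅ (Adj-sym x ◅ ε)

  ∈-back : ∀ {i j v} (w : Walk G i j) → v ∈ vertices (back w) → v ∈ vertices w
  ∈-back ε       z = z
  ∈-back (x ◅ w) z with ∈-◅◅ (back w) _ z
  ... | inj₁ l                = there (∈-back w l)
  ... | inj₂ (here refl)      = there (start∈ w)
  ... | inj₂ (there (here q)) = here q

  length≥2 : ∀ {i j} → i ≢ j → (w : Walk G i j) → 2 ≤ length (vertices w)
  length≥2 i≢j ε             = contradiction refl i≢j
  length≥2 i≢j (_ ◅ ε)       = s≤s (s≤s z≤n)
  length≥2 i≢j (_ ◅ (_ ◅ _)) = s≤s (s≤s z≤n)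

  detour : ∀ {i a b} → Adj i a → Adj i b → a ≢ b →
           (w : Walk G a b) → i ∉ vertices w → Cycle G
  detour ia ib a≢b w i∉w with walk⇒path w
  ... | p , p⊆w = record
    { path    = mkPath (ia ◅ walk p) (¬Any⇒All¬ _ (i∉w ∘ p⊆w) ∷ distinct p)
    ; long    = s≤s (length≥2 a≢b (walk p))
    ; closing = Adj-sym ib
    }

  walk-unique : ¬ Cycle G → ∀ {i j} (w w′ : Walk G i j) →
                Unique (vertices w) → Unique (vertices w′) →
                vertices w ≡ vertices w′
  walk-unique ac ε       ε        _       _ = refl
  walk-unique ac ε       (_ ◅ w′) _       (i∉ ∷ _) = contradiction (end∈ w′) (All¬⇒¬Any i∉)
  walk-unique ac (_ ◅ w) ε        (i∉ ∷ _) _       = contradiction (end∈ w) (All¬⇒¬Any i∉)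
  walk-unique ac (_◅_ {i} {a} x w) (_◅_ {_} {b} y w′) (i∉w ∷ u) (i∉w′ ∷ u′) with a ≟ b
  ... | yes refl = cong (i ∷_) (walk-unique ac w w′ u u′)
  ... | no  a≢b  = contradiction (detour x y a≢b (w ◅◅ back w′) i∉) ac
    where
    i∉ : i ∉ vertices (w ◅◅ back w′)
    i∉ z with ∈-◅◅ w (back w′) z
    ... | inj₁ l = All¬⇒¬Any i∉w l
    ... | inj₂ r = All¬⇒¬Any i∉w′ (∈-back w′ r)

  path-unique : ¬ Cycle G → ∀ {i j} (p q : Path G i j) →
                vertices (walk p) ≡ vertices (walk q)
  path-unique ac p q = walk-unique ac (walk p) (walk q) (distinct p) (distinct q)

next : {n : ℕ} {R : Fin n → Fin n → Set} {i j : Fin n} → Star R i j → i ≢ j → Fin n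
next ε                 i≢i = contradiction refl i≢i
next (_◅_ {j = k} _ _) _   = k

next-step : {n : ℕ} {R : Fin n → Fin n → Set} {i j : Fin n}
            (w : Star R i j) (i≢j : i ≢ j) → R i (next w i≢j)
next-step ε       i≢i = contradiction refl i≢i
next-step (x ◅ _) _   = x

-- A graph with a sink has at least one vertex, so V = Fin (suc m); the
-- non-sink vertices are indexed by Fin m through the bijection
-- ι = punchIn s : Fin m → V ∖ {s}.
module Sandpile {m : ℕ} (G : Multigraph (suc m)) (conn : Connected G)
                (s : Fin (suc m)) where

  open Multigraph G

  V₀ : Set
  V₀ = Fin m

  ι : V₀ → Fin (suc m)
  ι = punchIn s

  Config : Set
  Config = V₀ → ℕ

  _⊞_ : Config → Config → Config
  (u ⊞ v) i = u i + v i

  Unstable : Config → V₀ → Set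
  Unstable u i = deg (ι i) ≤ u i

  Stable : Config → Set
  Stable u = ∀ i → u i < deg (ι i)

  topple : Config → V₀ → Config
  topple u i j = if does (i ≟ j) then (u i ∸ deg (ι i)) + e (ι i) (ι i)
                                 else u j + e (ι i) (ι j)

  infix 4 _⟶*_

  -- Configurations are functions, hence compared pointwise.
  data _⟶*_ (u v : Config) : Set where
    done : u ≗ v → u ⟶* v
    step : ∀ i → Unstable u i → topple u i ⟶* v → u ⟶* v

  -- Some h : V → ℕ is strictly superharmonic off the sink,
  -- so ∑ u i * h i decreases at every toppling; hence stabilization
  -- terminates.

  private

    Within : ℕ → Fin (suc m) → Set
    Within zero    i = i ≡ s
    Within (suc k) i = Within k i ⊎ ∃[ j ] Adj i j × Within k j

    within? : ∀ k i → Dec (Within k i)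
    within? zero    i = i ≟ s
    within? (suc k) i = within? k i ⊎-dec any? (λ j → (0 <? e i j) ×-dec within? k j)

    within-mono : ∀ {k l i} → k ≤′ l → Within k i → Within l i
    within-mono ≤′-refl       w = w
    within-mono (≤′-step k≤l) w = inj₁ (within-mono k≤l w)

    walk⇒within : ∀ {i} → Walk G i s → ∃[ k ] Within k i
    walk⇒within ε       = 0 , refl
    walk⇒within (x ◅ w) with walk⇒within w
    ... | k , wk = suc k , inj₂ (_ , x , wk)

    Distance : Fin (suc m) → ℕ → Set
    Distance i d = Within d i × (∀ l → Within l i → d ≤ l)

    least : ∀ {i} k → Within k i → ∃ (Distance i)
    least     zero    w = 0 , w , λ _ _ → z≤n
    least {i} (suc k) w with within? k i
    ... | yes w′ = least k w′
    ... | no ¬w′ = suc k , w , λ l wl →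
            ≰⇒> λ l≤k → ¬w′ (within-mono (≤⇒≤′ l≤k) wl)

    distance : ∀ i → ∃ (Distance i)
    distance i = let k , w = walk⇒within (conn i s) in least k w

    d : Fin (suc m) → ℕ
    d i = proj₁ (distance i)

    closer : ∀ i → i ≢ s → ∃[ j ] Adj i j × d j < d i
    closer i i≢s with distance i
    ... | zero  , i≡s , _                  = contradiction i≡s i≢s
    ... | suc k , inj₁ w , min             = contradiction (min k w) (<-irrefl refl)
    ... | suc k , inj₂ (j , a , w) , _     = j , a , s≤s (proj₂ (proj₂ (distance j)) k w)

    ≤-sum : ∀ {n} (t : Fin (suc n) → ℕ) i → t i ≤ sum t
    ≤-sum t i = ≤-trans (m≤m+n (t i) _) (≤-reflexive (sym (sum-remove {i = i} t)))

    sum-removed≤ : ∀ {n} (t : Fin (suc n) → ℕ) i → sum (t ∘ punchIn i) ≤ sum t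
    sum-removed≤ t i = ≤-trans (m≤n+m _ (t i)) (≤-reflexive (sym (sum-remove {i = i} t)))

    N B : ℕ
    N = sum d
    B = suc (sum deg)

    g h : Fin (suc m) → ℕ
    g i = B ^ (N ∸ d i)
    h i = B ^ N ∸ g i

    h+g : ∀ i → h i + g i ≡ B ^ N
    h+g i = m∸n+n≡m (^-monoʳ-≤ B (m∸n≤m N (d i)))

    g-closer : ∀ i j → d j < d i → B * g i ≤ g j
    g-closer i j dj<di =
      ^-monoʳ-≤ B {suc (N ∸ d i)} {N ∸ d j} (∸-monoʳ-< dj<di (≤-sum d i))

    superharmonic : ∀ i → i ≢ s → sum (λ j → e i j * h j) < deg i * h i
    superharmonic i i≢s with closer i i≢s
    ... | j , a , dj<di = +-cancelʳ-< (sum (λ k → e i k * g k)) _ _ (begin-strict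
      sum (λ k → e i k * h k) + sum (λ k → e i k * g k)
        ≡⟨ ∑-distrib-+ (λ k → e i k * h k) (λ k → e i k * g k) ⟨
      sum (λ k → e i k * h k + e i k * g k)
        ≡⟨ sum-cong-≗ (λ k → trans (sym (*-distribˡ-+ (e i k) (h k) (g k)))
                                   (cong (e i k *_) (h+g k))) ⟩
      sum (λ k → e i k * B ^ N)
        ≡⟨ *-distribʳ-sum (B ^ N) (e i) ⟨
      deg i * B ^ N
        ≡⟨ cong (deg i *_) (h+g i) ⟨
      deg i * (h i + g i)
        ≡⟨ *-distribˡ-+ (deg i) (h i) (g i) ⟩
      deg i * h i + deg i * g i
        <⟨ +-monoʳ-< (deg i * h i) G<G′ ⟩
      deg i * h i + sum (λ k → e i k * g k) ∎)
      where
      open ≤-Reasoning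
      instance
        gi≢0 : NonZero (g i)
        gi≢0 = m^n≢0 B (N ∸ d i)
      G<G′ : deg i * g i < sum (λ k → e i k * g k)
      G<G′ = begin-strict
        deg i * g i             <⟨ *-monoˡ-< (g i) (s≤s (≤-sum deg i)) ⟩
        B * g i                 ≤⟨ g-closer i j dj<di ⟩
        g j                     ≡⟨ *-identityˡ (g j) ⟨
        1 * g j                 ≤⟨ *-monoˡ-≤ (g j) a ⟩
        e i j * g j             ≤⟨ ≤-sum (λ k → e i k * g k) j ⟩
        sum (λ k → e i k * g k) ∎

  spike : ∀ {n} (i : Fin n) (c : ℕ) (t : Fin n → ℕ) →
          sum (λ j → (if does (i ≟ j) then c else 0) * t j) ≡ c * t i
  spike {suc n} i c t = begin
    sum f                        ≡⟨ sum-remove {i = i} f ⟩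
    f i + sum (f ∘ punchIn i)    ≡⟨ cong₂ _+_ fi (trans (sum-cong-≗ fj) (sum-replicate-zero n)) ⟩
    c * t i + 0                  ≡⟨ +-identityʳ _ ⟩
    c * t i                      ∎
    where
    open ≡-Reasoning
    f : Fin (suc n) → ℕ
    f j = (if does (i ≟ j) then c else 0) * t j
    fi : f i ≡ c * t i
    fi with i ≟ i
    ... | yes _   = refl
    ... | no  i≢i = contradiction refl i≢i
    fj : ∀ j → f (punchIn i j) ≡ 0
    fj j with i ≟ punchIn i j
    ... | yes i≡  = contradiction (sym i≡) (punchInᵢ≢i i j)
    ... | no  _   = refl

  topple-balance : ∀ u i → Unstable u i → ∀ j →
    topple u i j + (if does (i ≟ j) then deg (ι i) else 0) ≡ u j + e (ι i) (ι j)
  topple-balance u i un j with i ≟ j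
  ... | yes refl = begin
    (u i ∸ deg (ι i)) + e (ι i) (ι i) + deg (ι i)   ≡⟨ +-assoc (u i ∸ deg (ι i)) _ _ ⟩
    (u i ∸ deg (ι i)) + (e (ι i) (ι i) + deg (ι i)) ≡⟨ cong ((u i ∸ deg (ι i)) +_) (+-comm _ (deg (ι i))) ⟩
    (u i ∸ deg (ι i)) + (deg (ι i) + e (ι i) (ι i)) ≡⟨ +-assoc (u i ∸ deg (ι i)) _ _ ⟨
    (u i ∸ deg (ι i)) + deg (ι i) + e (ι i) (ι i)   ≡⟨ cong (_+ e (ι i) (ι i)) (m∸n+n≡m un) ⟩
    u i + e (ι i) (ι i)                             ∎
    where open ≡-Reasoning
  ... | no _ = +-identityʳ _

  μ : Config → ℕ
  μ u = sum (λ i → u i * h (ι i))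

  μ-topple : ∀ u i → Unstable u i → μ (topple u i) < μ u
  μ-topple u i un = +-cancelʳ-< (deg (ι i) * h (ι i)) _ _ (begin-strict
    μ (topple u i) + deg (ι i) * h (ι i)
      ≡⟨ cong (μ (topple u i) +_) (spike i (deg (ι i)) (h ∘ ι)) ⟨
    μ (topple u i) + sum (λ j → δ j * h (ι j))
      ≡⟨ ∑-distrib-+ (λ j → topple u i j * h (ι j)) (λ j → δ j * h (ι j)) ⟨
    sum (λ j → topple u i j * h (ι j) + δ j * h (ι j))
      ≡⟨ sum-cong-≗ (λ j → trans (sym (*-distribʳ-+ (h (ι j)) (topple u i j) (δ j)))
                          (trans (cong (_* h (ι j)) (topple-balance u i un j))
                                 (*-distribʳ-+ (h (ι j)) (u j) _))) ⟩
    sum (λ j → u j * h (ι j) + e (ι i) (ι j) * h (ι j))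
      ≡⟨ ∑-distrib-+ (λ j → u j * h (ι j)) (λ j → e (ι i) (ι j) * h (ι j)) ⟩
    μ u + sum (λ j → e (ι i) (ι j) * h (ι j))
      ≤⟨ +-monoʳ-≤ (μ u) (sum-removed≤ (λ j → e (ι i) j * h j) s) ⟩
    μ u + sum (λ j → e (ι i) j * h j)
      <⟨ +-monoʳ-< (μ u) (superharmonic (ι i) (punchInᵢ≢i s i)) ⟩
    μ u + deg (ι i) * h (ι i) ∎)
    where
    open ≤-Reasoning
    δ : V₀ → ℕ
    δ j = if does (i ≟ j) then deg (ι i) else 0

  stabilize : ∀ u → Acc _<_ (μ u) → ∃[ v ] u ⟶* v × Stable v
  stabilize u (acc rec) with any? (λ i → deg (ι i) ≤? u i)
  ... | yes (i , un) = let v , r , st = stabilize (topple u i) (rec (μ-topple u i un))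
                       in v , step i un r , st
  ... | no  none     = u , done (λ _ → refl) , λ i → ≰⇒> λ un → none (i , un)

  σ : Config → Config
  σ u = proj₁ (stabilize u (<-wellFounded (μ u)))

  ⟶*-σ : ∀ u → u ⟶* σ u
  ⟶*-σ u = proj₁ (proj₂ (stabilize u (<-wellFounded (μ u))))

  σ-stable : ∀ u → Stable (σ u)
  σ-stable u = proj₂ (proj₂ (stabilize u (<-wellFounded (μ u))))

  ≗-trans : {u v w : Config} → u ≗ v → v ≗ w → u ≗ w
  ≗-trans p q i = trans (p i) (q i)

  ≗-sym : {u v : Config} → u ≗ v → v ≗ u
  ≗-sym p i = sym (p i)

  unstable-resp : ∀ {u v i} → u ≗ v → Unstable u i → Unstable v i
  unstable-resp {i = i} p = subst (deg (ι i) ≤_) (p i)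

  topple-cong : ∀ {u v} i → u ≗ v → topple u i ≗ topple v i
  topple-cong i p j with i ≟ j
  ... | yes _ = cong (λ x → (x ∸ deg (ι i)) + e (ι i) (ι i)) (p i)
  ... | no  _ = cong (_+ e (ι i) (ι j)) (p j)

  ⟶*-respˡ : ∀ {u v w} → u ≗ v → u ⟶* w → v ⟶* w
  ⟶*-respˡ p (done q)      = done (≗-trans (≗-sym p) q)
  ⟶*-respˡ p (step i un r) = step i (unstable-resp p un) (⟶*-respˡ (topple-cong i p) r)

  ⟶*-trans : ∀ {u v w} → u ⟶* v → v ⟶* w → u ⟶* w
  ⟶*-trans (done p)      r = ⟶*-respˡ (≗-sym p) r
  ⟶*-trans (step i un q) r = step i un (⟶*-trans q r)

  stable-done : ∀ {u v} → Stable u → u ⟶* v → u ≗ v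
  stable-done st (done p)      = p
  stable-done st (step i un _) = contradiction un (<⇒≱ (st i))

  topple-other : ∀ u {i j} → i ≢ j → topple u i j ≡ u j + e (ι i) (ι j)
  topple-other u {i} {j} i≢j with i ≟ j
  ... | yes i≡j = contradiction i≡j i≢j
  ... | no  _   = refl

  topple-self : ∀ u i → topple u i i ≡ (u i ∸ deg (ι i)) + e (ι i) (ι i)
  topple-self u i with i ≟ i
  ... | yes _   = refl
  ... | no  i≢i = contradiction refl i≢i

  still-unstable : ∀ u {i j} → i ≢ j → Unstable u j → Unstable (topple u i) j
  still-unstable u i≢j un =
    ≤-trans un (≤-trans (m≤m+n _ _) (≤-reflexive (sym (topple-other u i≢j))))

  move : ∀ a b c d′ → d′ ≤ a → ((a + b) ∸ d′) + c ≡ ((a ∸ d′) + c) + b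
  move a b c d′ d≤a = begin
    ((a + b) ∸ d′) + c ≡⟨ cong (_+ c) (+-∸-comm b d≤a) ⟩
    ((a ∸ d′) + b) + c ≡⟨ +-assoc (a ∸ d′) b c ⟩
    (a ∸ d′) + (b + c) ≡⟨ cong ((a ∸ d′) +_) (+-comm b c) ⟩
    (a ∸ d′) + (c + b) ≡⟨ +-assoc (a ∸ d′) c b ⟨
    ((a ∸ d′) + c) + b ∎
    where open ≡-Reasoning

  swap-self : ∀ u {i j} → i ≢ j → Unstable u i →
              topple (topple u i) j i ≡ topple (topple u j) i i
  swap-self u {i} {j} i≢j un = begin
    topple (topple u i) j i                                        ≡⟨ topple-other (topple u i) (i≢j ∘ sym) ⟩
    topple u i i + e (ι j) (ι i)                                   ≡⟨ cong (_+ e (ι j) (ι i)) (topple-self u i) ⟩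
    ((u i ∸ deg (ι i)) + e (ι i) (ι i)) + e (ι j) (ι i)            ≡⟨ move (u i) _ _ _ un ⟨
    ((u i + e (ι j) (ι i)) ∸ deg (ι i)) + e (ι i) (ι i)            ≡⟨ cong (λ x → (x ∸ deg (ι i)) + e (ι i) (ι i)) (topple-other u (i≢j ∘ sym)) ⟨
    (topple u j i ∸ deg (ι i)) + e (ι i) (ι i)                     ≡⟨ topple-self (topple u j) i ⟨
    topple (topple u j) i i                                        ∎
    where open ≡-Reasoning

  swap : ∀ u {i j} → i ≢ j → Unstable u i → Unstable u j →
         topple (topple u i) j ≗ topple (topple u j) i
  swap u {i} {j} i≢j uni unj k = go (i ≟ k) (j ≟ k)
    where
    open ≡-Reasoning
    go : Dec (i ≡ k) → Dec (j ≡ k) → topple (topple u i) j k ≡ topple (topple u j) i k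
    go (yes refl) _          = swap-self u i≢j uni
    go (no _)     (yes refl) = sym (swap-self u (i≢j ∘ sym) unj)
    go (no i≢k)   (no j≢k)   = begin
      topple (topple u i) j k                 ≡⟨ topple-other (topple u i) j≢k ⟩
      topple u i k + e (ι j) (ι k)            ≡⟨ cong (_+ e (ι j) (ι k)) (topple-other u i≢k) ⟩
      (u k + e (ι i) (ι k)) + e (ι j) (ι k)   ≡⟨ +-assoc (u k) _ _ ⟩
      u k + (e (ι i) (ι k) + e (ι j) (ι k))   ≡⟨ cong (u k +_) (+-comm (e (ι i) (ι k)) _) ⟩
      u k + (e (ι j) (ι k) + e (ι i) (ι k))   ≡⟨ +-assoc (u k) _ _ ⟨
      (u k + e (ι j) (ι k)) + e (ι i) (ι k)   ≡⟨ cong (_+ e (ι i) (ι k)) (topple-other u j≢k) ⟨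
      topple u j k + e (ι i) (ι k)            ≡⟨ topple-other (topple u j) i≢k ⟨
      topple (topple u j) i k                 ∎

  confluent : ∀ {u v w} → Acc _<_ (μ u) →
              u ⟶* v → Stable v → u ⟶* w → Stable w → v ≗ w
  confluent _ (done p) sv r sw =
    stable-done sv (⟶*-respˡ p r)
  confluent _ (step i un q) sv (done p) sw =
    contradiction (unstable-resp p un) (<⇒≱ (sw i))
  confluent {u} (acc rec) (step i uni q) sv (step j unj r) sw with i ≟ j
  ... | yes refl = confluent (rec (μ-topple u i uni)) q sv r sw
  ... | no i≢j   = ≗-trans
    (confluent (rec (μ-topple u i uni)) q sv
      (step j (still-unstable u i≢j unj) (⟶*-σ c)) (σ-stable c))
    (confluent (rec (μ-topple u j unj))
      (step i (still-unstable u (i≢j ∘ sym) uni)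
        (⟶*-respˡ (swap u i≢j uni unj) (⟶*-σ c))) (σ-stable c) r sw)
    where
    c : Config
    c = topple (topple u i) j

  σ-unique : ∀ {u v} → u ⟶* v → Stable v → σ u ≗ v
  σ-unique {u} r st = confluent (<-wellFounded (μ u)) (⟶*-σ u) (σ-stable u) r st

  infixl 6 _⊞_ _⊕_

  _⊕_ : Config → Config → Config
  u ⊕ v = σ (u ⊞ v)

  Recurrent : Config → Set
  Recurrent u = ∀ v → ∃[ w ] v ⊕ w ≗ u

  σ-cong : ∀ {u v} → u ≗ v → σ u ≗ σ v
  σ-cong {u} {v} p = σ-unique (⟶*-respˡ (≗-sym p) (⟶*-σ v)) (σ-stable v)

  ⊕-cong : ∀ {u u′ v v′} → u ≗ u′ → v ≗ v′ → u ⊕ v ≗ u′ ⊕ v′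
  ⊕-cong p q = σ-cong (λ i → cong₂ _+_ (p i) (q i))

  ⊕-comm : ∀ u v → u ⊕ v ≗ v ⊕ u
  ⊕-comm u v = σ-cong (λ i → +-comm (u i) (v i))

  topple-⊞ : ∀ u v i → Unstable u i → topple (u ⊞ v) i ≗ topple u i ⊞ v
  topple-⊞ u v i un j with i ≟ j
  ... | yes refl = move (u i) (v i) _ _ un
  ... | no _     = trans (+-assoc (u j) _ _)
                  (trans (cong (u j +_) (+-comm (v j) _)) (sym (+-assoc (u j) _ _)))

  ⟶*-⊞ : ∀ {u w} v → u ⟶* w → u ⊞ v ⟶* w ⊞ v
  ⟶*-⊞         v (done p)      = done (λ i → cong (_+ v i) (p i))
  ⟶*-⊞ {u = u} v (step i un r) =
    step i (≤-trans un (m≤m+n _ _)) (⟶*-respˡ (≗-sym (topple-⊞ u v i un)) (⟶*-⊞ v r))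

  σ-⊕ : ∀ u v → σ u ⊕ v ≗ u ⊕ v
  σ-⊕ u v = ≗-sym (σ-unique (⟶*-trans (⟶*-⊞ v (⟶*-σ u)) (⟶*-σ _)) (σ-stable _))

  ⊕-assoc : ∀ u v w → (u ⊕ v) ⊕ w ≗ u ⊕ (v ⊕ w)
  ⊕-assoc u v w =
    ≗-trans (σ-⊕ (u ⊞ v) w)
    (≗-trans (σ-cong (λ i → trans (+-assoc (u i) _ _) (+-comm (u i) _)))
    (≗-trans (≗-sym (σ-⊕ (v ⊞ w) u)) (⊕-comm (v ⊕ w) u)))

  recurrent-⊕ : ∀ {u} v → Recurrent u → Recurrent (u ⊕ v)
  recurrent-⊕ {u} v ru x =
    let w , eq = ru x
    in  w ⊕ v , ≗-trans (≗-sym (⊕-assoc x w v)) (⊕-cong eq λ _ → refl)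

  private

    maxStable : Config
    maxStable i = pred (deg (ι i))

    σ-on-stable : ∀ {u} → Stable u → σ u ≗ u
    σ-on-stable = σ-unique (done λ _ → refl)

    pred< : ∀ {x y} → x < y → pred y < y
    pred< (s≤s _) = ≤-refl

    maxStable-recurrent : Recurrent maxStable
    maxStable-recurrent v = w , ≗-trans (≗-sym (σ-⊕ v w)) (≗-trans (σ-cong fill) (σ-on-stable ms))
      where
      w : Config
      w i = maxStable i ∸ σ v i
      fill : σ v ⊞ w ≗ maxStable
      fill i = m+[n∸m]≡n (<⇒≤pred (σ-stable v i))
      ms : Stable maxStable
      ms i = pred< (σ-stable v i)

    spare unit : Config
    spare = proj₁ (maxStable-recurrent (maxStable ⊕ maxStable))
    unit = maxStable ⊕ spare

    unit-recurrent : Recurrent unit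
    unit-recurrent = recurrent-⊕ spare maxStable-recurrent

    unit-identity : maxStable ⊕ unit ≗ maxStable
    unit-identity = ≗-trans (≗-sym (⊕-assoc maxStable maxStable spare))
                         (proj₂ (maxStable-recurrent (maxStable ⊕ maxStable)))

    identityˡ : ∀ u → Recurrent u → unit ⊕ u ≗ u
    identityˡ u ru =
      let x , eq = ru maxStable
      in ≗-trans (⊕-cong (λ _ → refl) (≗-sym eq))
        (≗-trans (≗-sym (⊕-assoc unit maxStable x))
        (≗-trans (⊕-cong (≗-trans (⊕-comm unit maxStable) unit-identity) (λ _ → refl)) eq))

    identityʳ : ∀ u → Recurrent u → u ⊕ unit ≗ u
    identityʳ u ru = ≗-trans (⊕-comm u unit) (identityˡ u ru)

    inv : ∀ u → Recurrent u → Config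
    inv u ru = unit ⊕ proj₁ (unit-recurrent u)

    inv-recurrent : ∀ u ru → Recurrent (inv u ru)
    inv-recurrent u ru = recurrent-⊕ _ unit-recurrent

    inverseʳ : ∀ u ru → u ⊕ inv u ru ≗ unit
    inverseʳ u ru = let x = proj₁ (unit-recurrent u) in
      ≗-trans (≗-sym (⊕-assoc u unit x))
      (≗-trans (⊕-cong (identityʳ u ru) (λ _ → refl)) (proj₂ (unit-recurrent u)))

    inverseˡ : ∀ u ru → inv u ru ⊕ u ≗ unit
    inverseˡ u ru = ≗-trans (⊕-comm _ u) (inverseʳ u ru)

    inv-cong : ∀ {u v} ru rv → u ≗ v → inv u ru ≗ inv v rv
    inv-cong {u} {v} ru rv p =
      ≗-trans (≗-sym (identityʳ _ (inv-recurrent u ru)))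
      (≗-trans (⊕-cong (λ _ → refl) (≗-sym (≗-trans (⊕-cong p (λ _ → refl)) (inverseʳ v rv))))
      (≗-trans (≗-sym (⊕-assoc (inv u ru) u (inv v rv)))
      (≗-trans (⊕-cong (inverseˡ u ru) (λ _ → refl)) (identityˡ _ (inv-recurrent v rv)))))

  sandpileGroup : AbelianGroup 0ℓ 0ℓ
  sandpileGroup = record
    { Carrier = ∃ Recurrent
    ; _≈_     = λ a b → proj₁ a ≗ proj₁ b
    ; _∙_     = λ (u , ru) (v , _) → u ⊕ v , recurrent-⊕ v ru
    ; ε       = unit , unit-recurrent
    ; _⁻¹     = λ (u , ru) → inv u ru , inv-recurrent u ru
    ; isAbelianGroup = record
      { isGroup = record
        { isMonoid = record
          { isSemigroup = record
            { isMagma = record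
              { isEquivalence = record
                { refl = λ _ → refl ; sym = ≗-sym ; trans = ≗-trans }
              ; ∙-cong = ⊕-cong
              }
            ; assoc = λ (u , _) (v , _) (w , _) → ⊕-assoc u v w
            }
          ; identity = (λ (u , ru) → identityˡ u ru) , (λ (u , ru) → identityʳ u ru)
          }
        ; inverse = (λ (u , ru) → inverseˡ u ru) , (λ (u , ru) → inverseʳ u ru)
        ; ⁻¹-cong = λ {a} {b} → inv-cong (proj₂ a) (proj₂ b)
        }
      ; comm = λ (u , _) (v , _) → ⊕-comm u v
      }
    }

-- ℤ/kℤ as the setoid of integers modulo congruence.
ℤ/_ : ℕ → AbelianGroup 0ℓ 0ℓ
ℤ/ k = record
  { Carrier = ℤ
  ; _≈_     = _≈_
  ; _∙_     = ℤ._+_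
  ; ε       = ℤ.0ℤ
  ; _⁻¹     = ℤ.-_
  ; isAbelianGroup = record
    { isGroup = record
      { isMonoid = record
        { isSemigroup = record
          { isMagma = record
            { isEquivalence = record
              { refl  = λ {a} → reflexive {a} refl
              ; sym   = λ {a} {b} p → subst (+k ∣_) (flip a b) (∣m⇒∣-m p)
              ; trans = λ {a} {b} {c} p q → subst (+k ∣_) (chain a b c) (∣m∣n⇒∣m+n p q)
              }
            ; ∙-cong = λ {a} {a′} {b} {b′} p q → subst (+k ∣_) (add a a′ b b′) (∣m∣n⇒∣m+n p q)
            }
          ; assoc = λ a b c → reflexive (ℤ.+-assoc a b c)
          }
        ; identity = (λ a → reflexive (ℤ.+-identityˡ a)) , (λ a → reflexive (ℤ.+-identityʳ a))
        }
      ; inverse = (λ a → reflexive (ℤ.+-inverseˡ a)) , (λ a → reflexive (ℤ.+-inverseʳ a))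
      ; ⁻¹-cong = λ {a} {b} p → subst (+k ∣_) (negate a b) (∣m⇒∣-m p)
      }
    ; comm = λ a b → reflexive (ℤ.+-comm a b)
    }
  }
  where
  +k : ℤ
  +k = ℤ.+ k

  _≈_ : ℤ → ℤ → Set
  a ≈ b = +k ∣ a ℤ.- b

  reflexive : ∀ {a b} → a ≡ b → a ≈ b
  reflexive {a} refl = divides ℤ.0ℤ (trans (ℤ.+-inverseʳ a) (sym (ℤ.*-zeroˡ +k)))

  flip : ∀ a b → ℤ.- (a ℤ.- b) ≡ b ℤ.- a
  flip = solve-∀

  chain : ∀ a b c → (a ℤ.- b) ℤ.+ (b ℤ.- c) ≡ a ℤ.- c
  chain = solve-∀

  add : ∀ a a′ b b′ → (a ℤ.- a′) ℤ.+ (b ℤ.- b′) ≡ (a ℤ.+ b) ℤ.- (a′ ℤ.+ b′)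
  add = solve-∀

  negate : ∀ a b → ℤ.- (a ℤ.- b) ≡ (ℤ.- a) ℤ.- (ℤ.- b)
  negate = solve-∀

∏ : {m : ℕ} → (Fin m → AbelianGroup 0ℓ 0ℓ) → AbelianGroup 0ℓ 0ℓ
∏ {m} A = record
  { Carrier = ∀ j → A.Carrier j
  ; _≈_     = λ a b → ∀ j → A._≈_ j (a j) (b j)
  ; _∙_     = λ a b j → A._∙_ j (a j) (b j)
  ; ε       = λ j → A.ε j
  ; _⁻¹     = λ a j → A._⁻¹ j (a j)
  ; isAbelianGroup = record
    { isGroup = record
      { isMonoid = record
        { isSemigroup = record
          { isMagma = record
            { isEquivalence = record
              { refl  = λ j → A.refl j
              ; sym   = λ p j → A.sym j (p j)
              ; trans = λ p q j → A.trans j (p j) (q j)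
              }
            ; ∙-cong = λ p q j → A.∙-cong j (p j) (q j)
            }
          ; assoc = λ a b c j → A.assoc j (a j) (b j) (c j)
          }
        ; identity = (λ a j → A.identityˡ j (a j)) , (λ a j → A.identityʳ j (a j))
        }
      ; inverse = (λ a j → A.inverseˡ j (a j)) , (λ a j → A.inverseʳ j (a j))
      ; ⁻¹-cong = λ p j → A.⁻¹-cong j (p j)
      }
    ; comm = λ a b j → A.comm j (a j) (b j)
    }
  }
  where module A (j : Fin m) = AbelianGroup (A j)

IsIsomorphism : (A B : AbelianGroup 0ℓ 0ℓ) →
                (AbelianGroup.Carrier A → AbelianGroup.Carrier B) → Set
IsIsomorphism A B =
  GroupMorphisms.IsGroupIsomorphism (AbelianGroup.rawGroup A) (AbelianGroup.rawGroup B)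

_≅_ : (A B : AbelianGroup 0ℓ 0ℓ) → Set
A ≅ B = ∃[ θ ] IsIsomorphism A B θ

module Rooted {m : ℕ} (T : ThickTree (suc m)) (s : Fin (suc m)) where

  open ThickTree T public
  open Multigraph graph public
  open Sandpile graph connected s public

  T′ : Multigraph (suc m)
  T′ = simplify graph

  toSink : ∀ i → Path T′ i s
  toSink i = proj₁ (Paths.walk⇒path T′ (proj₁ isTree i s))

  -- So ⪰ and p do not depend on how the path was chosen.
  toSink-unique : ∀ {i} (p : Path T′ i s) → vertices (walk p) ≡ vertices (walk (toSink i))
  toSink-unique p = Paths.path-unique T′ (proj₂ isTree) p (toSink _)

  infix 4 _⪰_ _≻_ _⪰?_ _≻?_

  _⪰_ _≻_ : Fin (suc m) → Fin (suc m) → Set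
  i ⪰ j = j ∈ vertices (walk (toSink i))
  i ≻ j = i ⪰ j × i ≢ j

  _⪰?_ : ∀ i j → Dec (i ⪰ j)
  i ⪰? j = j ∈? vertices (walk (toSink i))
    where open DecMembership (_≟_ {suc m}) using (_∈?_)

  _≻?_ : ∀ i j → Dec (i ≻ j)
  i ≻? j = (i ⪰? j) ×-dec ¬? (i ≟ j)

  p : V₀ → Fin (suc m)
  p j = next (walk (toSink (ι j))) (punchInᵢ≢i s j)

  p-Adj : ∀ j → Multigraph.Adj T′ (ι j) (p j)
  p-Adj j = next-step (walk (toSink (ι j))) (punchInᵢ≢i s j)

  w : V₀ → ℕ
  w j = e (ι j) (p j)

  instance
    w-nonZero : ∀ {j} → NonZero (w j)
    w-nonZero {j} = >-nonZero (simplify-Adj graph (p-Adj j))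

  -- So deg (ι j) ∸ w j is an honest difference.
  w≤deg : ∀ j → w j ≤ deg (ι j)
  w≤deg j = ≤-trans (m≤m+n (w j) _) (≤-reflexive (sym (sum-remove {i = p j} (e (ι j)))))

  Leaf : V₀ → Set
  Leaf j = Multigraph.deg T′ (ι j) ≡ 1

  -- If a leaf j carries a loop, then every recurrent configuration has
  -- u j ≥ deg j ∸ w j = e j j > 0, so u j need not be the standard
  -- representative of a class modulo w j.
  LooplessLeaf : V₀ → Set
  LooplessLeaf j = Leaf j × e (ι j) (ι j) ≡ 0

  ∑⪰ ∑≻ : V₀ → Config → ℕ
  ∑⪰ j u = sum (λ i → if does (ι i ⪰? ι j) then u i else 0)
  ∑≻ j u = sum (λ i → if does (ι i ≻? ι j) then u i else 0)

  ∏ℤ/w : AbelianGroup 0ℓ 0ℓ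
  ∏ℤ/w = ∏ (λ j → ℤ/ w j)

  φ : AbelianGroup.Carrier sandpileGroup → AbelianGroup.Carrier ∏ℤ/w
  φ (u , _) j = ℤ.+ ∑⪰ j u

  rep : AbelianGroup.Carrier ∏ℤ/w → V₀ → ℕ
  rep v j = v j %ℕ w j

  -- The lemmas f-lower, f-upper and f-mod say that f j a is the integer in
  -- {deg j − w j, …, deg j − 1} congruent to a; f-unique, that it is the only one.
  f : V₀ → ℤ → ℕ
  f j a = low + ((a ℤ.- ℤ.+ low) %ℕ w j)
    where
    low : ℕ
    low = deg (ι j) ∸ w j

  f-lower : ∀ j a → deg (ι j) ∸ w j ≤ f j a
  f-lower j a = m≤m+n _ _

  f-upper : ∀ j a → f j a < deg (ι j)
  f-upper j a = <-≤-trans (+-monoʳ-< (deg (ι j) ∸ w j) (n%ℕd<d (a ℤ.- ℤ.+ (deg (ι j) ∸ w j)) (w j)))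
                          (≤-reflexive (m∸n+n≡m (w≤deg j)))

  f-mod : ∀ j a → ℤ.+ w j ∣ ℤ.+ f j a ℤ.- a
  f-mod j a = divides (ℤ.- q) (begin
    ℤ.+ f j a ℤ.- a                             ≡⟨ cong (ℤ._- a) (ℤ.pos-+ low r) ⟩
    (ℤ.+ low ℤ.+ ℤ.+ r) ℤ.- a                   ≡⟨ shuffle₁ (ℤ.+ low) (ℤ.+ r) a ⟩
    ℤ.+ r ℤ.- (a ℤ.- ℤ.+ low)                   ≡⟨ cong (λ x → ℤ.+ r ℤ.- x) (a≡a%ℕn+[a/ℕn]*n (a ℤ.- ℤ.+ low) (w j)) ⟩
    ℤ.+ r ℤ.- (ℤ.+ r ℤ.+ q ℤ.* ℤ.+ w j)         ≡⟨ shuffle₂ (ℤ.+ r) q (ℤ.+ w j) ⟩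
    ℤ.- q ℤ.* ℤ.+ w j                           ∎)
    where
    open ≡-Reasoning
    low r : ℕ
    low = deg (ι j) ∸ w j
    r = (a ℤ.- ℤ.+ low) %ℕ w j
    q : ℤ
    q = (a ℤ.- ℤ.+ low) /ℕ w j
    shuffle₁ : ∀ x y z → (x ℤ.+ y) ℤ.- z ≡ y ℤ.- (z ℤ.- x)
    shuffle₁ = solve-∀
    shuffle₂ : ∀ x y z → x ℤ.- (x ℤ.+ y ℤ.* z) ≡ ℤ.- y ℤ.* z
    shuffle₂ = solve-∀

  private

    small-multiple : ∀ {k} n → k ℕ.∣ n → n < k → n ≡ 0
    small-multiple zero    _   _   = refl
    small-multiple (suc n) k∣n n<k = contradiction (ℕ.∣⇒≤ k∣n) (<⇒≱ n<k)

    close⇒≡ : ∀ {k low x y} → low ≤ x → y < low + k →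
              ℤ.+ k ∣ ℤ.+ x ℤ.- ℤ.+ y → x ≤ y → x ≡ y
    close⇒≡ {k} {low} {x} {y} l≤x y< k∣ x≤y =
      ≤-antisym x≤y (m∸n≡0⇒m≤n (small-multiple (y ∸ x) k∣y∸x y∸x<k))
      where
      k∣y∸x : k ℕ.∣ y ∸ x
      k∣y∸x = subst (k ℕ.∣_) (trans (cong ℤ.∣_∣ (ℤ.m-n≡m⊖n x y)) (ℤ.∣⊖∣-≤ x≤y)) (∣⇒∣ᵤ k∣)
      y∸x<k : y ∸ x < k
      y∸x<k = +-cancelˡ-< x _ _ (≤-<-trans (≤-reflexive (m+[n∸m]≡n x≤y))
                (<-≤-trans y< (+-monoˡ-≤ k l≤x)))

  f-unique : ∀ j a x → deg (ι j) ∸ w j ≤ x → x < deg (ι j) →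
             ℤ.+ w j ∣ ℤ.+ x ℤ.- a → x ≡ f j a
  f-unique j a x l≤x x<d x≡a = go (≤-total x (f j a))
    where
    module mod = AbelianGroup (ℤ/ w j)
    up : ∀ {z} → z < deg (ι j) → z < (deg (ι j) ∸ w j) + w j
    up {z} = subst (z <_) (sym (m∸n+n≡m (w≤deg j)))
    x≡f : ℤ.+ w j ∣ ℤ.+ x ℤ.- ℤ.+ f j a
    x≡f = mod.trans {ℤ.+ x} {a} {ℤ.+ f j a} x≡a (mod.sym {ℤ.+ f j a} {a} (f-mod j a))
    go : x ≤ f j a ⊎ f j a ≤ x → x ≡ f j a
    go (inj₁ x≤f) = close⇒≡ l≤x (up (f-upper j a)) x≡f x≤f
    go (inj₂ f≤x) = sym (close⇒≡ (f-lower j a) (up x<d) (mod.sym {ℤ.+ x} {ℤ.+ f j a} x≡f) f≤x)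

{-# OPTIONS --safe #-}

-- (i) Call a set S forbidden for u if each v ∈ S has fewer chips than edges
-- to S, loops included. Toppling creates no forbidden sets, and a
-- configuration with u i ≥ deg i everywhere has none, so neither has a
-- recurrent one. In a thick tree, all edges at a vertex v ≻ j end in the subtree
-- above j, so for a stable u only j itself can witness that this subtree is not
-- forbidden, and hence u j ≥ deg j − w j.
--
-- (ii), (iii) The edges leaving the subtree above j are the w j edges from j to
-- p j, so toppling preserves ∑⪰ j modulo w j. A configuration in the box (i)
-- has φ u = v iff u j = f j (v j − ∑≻ j u) for all j, a recursion from the
-- leaves to the sink with exactly one solution. A configuration u in
-- the box is recurrent, because u and the recurrent u ⊕ unit have the same
-- image under φ. Changing the sink only redistributes the edges {j, p j} of T′
-- among the labels j.
module Submission where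

open import Defs
open import Algebra.Bundles using (AbelianGroup)
import Algebra.Morphism.Construct.Composition as Composition
open import Algebra.Morphism.Structures using (module GroupMorphisms)
import Algebra.Properties.Group as GroupProperties
open import Data.Bool.Base using (true; false; if_then_else_)
open import Data.Fin.Base using (Fin; zero; suc; punchIn; punchOut)
import Data.Fin.Induction as Fin using (spo-wellFounded)
open import Data.Fin.Permutation
  using (Permutation′; permutation; _⟨$⟩ʳ_; _⟨$⟩ˡ_; inverseˡ; inverseʳ)
open import Data.Fin.Properties
  using (_≟_; any?; punchInᵢ≢i; punchIn-injective; punchIn-punchOut)
open import Data.Integer.Base as ℤ using (ℤ; +_; _-_)
open import Data.Integer.Divisibility.Signed using (_∣_; divides; ∣-refl; ∣m∣n⇒∣m+n)
open import Data.Integer.DivMod using (_/ℕ_; n%ℕd<d; a≡a%ℕn+[a/ℕn]*n)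
import Data.Integer.Properties as ℤ
open import Data.Integer.Tactic.RingSolver using (solve-∀)
open import Data.List.Base using (List; []; _∷_; _++_; length)
import Data.List.Membership.DecPropositional as DecMembership
open import Data.List.Membership.Propositional using (_∈_)
open import Data.List.Membership.Propositional.Properties using (∈-++⁺ʳ)
open import Data.List.Properties using (∷-injectiveˡ; ∷-injectiveʳ; length-++)
open import Data.List.Relation.Unary.All.Properties using (¬Any⇒All¬; All¬⇒¬Any)
open import Data.List.Relation.Unary.AllPairs using (_∷_)
open import Data.List.Relation.Unary.Any using (here; there)
open import Data.List.Relation.Unary.Unique.Propositional using (Unique)
open import Data.Nat.Base
open import Data.Nat.Properties hiding (_≟_)
open import Data.Product.Base using (∃; ∃-syntax; Σ-syntax; _×_; _,_; proj₁; proj₂)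
open import Data.Sum.Base using (_⊎_; inj₁; inj₂)
open import Function.Base using (_∘_)
open import Function.Bundles using (_⇔_; mk⇔)
open import Function.Definitions
  using (Congruent; Injective; StrictlySurjective; Inverseᵇ)
import Induction.WellFounded as WF
open import Level using (0ℓ)
open import Relation.Binary.Construct.Closure.ReflexiveTransitive using (Star; ε; _◅_)
open import Relation.Binary.PropositionalEquality
open import Relation.Nullary.Decidable using (Dec; yes; no; does; _×-dec_; ¬?)
open import Relation.Nullary.Negation using (¬_; contradiction)
open import Relation.Unary using (Pred; Decidable)

-- Isomorphisms of abelian groups

module _ (A B : AbelianGroup 0ℓ 0ℓ) where

  private
    module A = AbelianGroup A
    module B = AbelianGroup B
  open GroupMorphisms A.rawGroup B.rawGroup using (IsGroupIsomorphism)

  -- In a group, `x ∙ x ≈ x` forces `x ≈ ε` and left inverses are unique, so multiplicativity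
  -- already gives the unit and inverse laws.
  isIsomorphism : (θ : A.Carrier → B.Carrier) →
                  Congruent A._≈_ B._≈_ θ →
                  (∀ x y → θ (x A.∙ y) B.≈ (θ x B.∙ θ y)) →
                  Injective A._≈_ B._≈_ θ →
                  StrictlySurjective B._≈_ θ →
                  IsIsomorphism A B θ
  isIsomorphism θ θ-cong homo injective surjective = record
    { isGroupMonomorphism = record
      { isGroupHomomorphism = record
        { isMonoidHomomorphism = record
          { isMagmaHomomorphism = record
            { isRelHomomorphism = record { cong = θ-cong }
            ; homo = homo
            }
          ; ε-homo = ε-homo
          }
        ; ⁻¹-homo = λ x → inverseˡ-unique (θ (x A.⁻¹)) (θ x)
            (B.trans (B.sym (homo (x A.⁻¹) x)) (B.trans (θ-cong (A.inverseˡ x)) ε-homo))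
        }
      ; injective = injective
      }
    ; surjective = λ y → let x , θx≈y = surjective y in
        x , λ z≈x → B.trans (θ-cong z≈x) θx≈y
    }
    where
    open GroupProperties B.group using (identityˡ-unique; inverseˡ-unique)
    ε-homo : θ A.ε B.≈ B.ε
    ε-homo = identityˡ-unique (θ A.ε) (θ A.ε)
      (B.trans (B.sym (homo A.ε A.ε)) (θ-cong (A.identityˡ A.ε)))

≅-sym : ∀ {A B} → A ≅ B → B ≅ A
≅-sym {A} {B} (θ , iso) = θ⁻¹ , isIsomorphism B A θ⁻¹
    (λ {x} {y} x≈y → injective (B.trans (θθ⁻¹ x) (B.trans x≈y (B.sym (θθ⁻¹ y)))))
    (λ x y → injective (B.trans (θθ⁻¹ (x B.∙ y))
      (B.trans (B.∙-cong (B.sym (θθ⁻¹ x)) (B.sym (θθ⁻¹ y)))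
               (B.sym (∙-homo (θ⁻¹ x) (θ⁻¹ y))))))
    (λ {x} {y} p → B.trans (B.sym (θθ⁻¹ x)) (B.trans (⟦⟧-cong p) (θθ⁻¹ y)))
    (λ x → θ x , injective (θθ⁻¹ (θ x)))
  where
  module A = AbelianGroup A
  module B = AbelianGroup B
  open GroupMorphisms.IsGroupIsomorphism iso
  θ⁻¹ : B.Carrier → A.Carrier
  θ⁻¹ y = proj₁ (surjective y)
  θθ⁻¹ : ∀ y → θ (θ⁻¹ y) B.≈ y
  θθ⁻¹ y = proj₂ (surjective y) A.refl

≅-trans : ∀ {A B C} → A ≅ B → B ≅ C → A ≅ C
≅-trans {C = C} (θ , θ-iso) (η , η-iso) =
  η ∘ θ , Composition.isGroupIsomorphism (AbelianGroup.trans C) θ-iso η-iso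

-- Finite sums and sums over decidable subsets

sum-mono-≤ : ∀ {n} {f g : Fin n → ℕ} → (∀ i → f i ≤ g i) → sum f ≤ sum g
sum-mono-≤ {zero}  f≤g = z≤n
sum-mono-≤ {suc n} f≤g = +-mono-≤ (f≤g zero) (sum-mono-≤ (f≤g ∘ suc))

sum-zero : ∀ {n} {f : Fin n → ℕ} → (∀ i → f i ≡ 0) → sum f ≡ 0
sum-zero {n} f≡0 = trans (sum-cong-≗ f≡0) (sum-replicate-zero n)

sum-remove-≤ : ∀ {n} (f : Fin (suc n) → ℕ) i → sum (f ∘ punchIn i) ≤ sum f
sum-remove-≤ f i = ≤-trans (m≤n+m _ (f i)) (≤-reflexive (sym (sum-remove {i = i} f)))

sum-remove-zero : ∀ {n} (f : Fin (suc n) → ℕ) i → f i ≡ 0 → sum f ≡ sum (f ∘ punchIn i)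
sum-remove-zero f i fi≡0 = trans (sum-remove {i = i} f) (cong (_+ sum (f ∘ punchIn i)) fi≡0)

term≤sum : ∀ {n} (f : Fin n → ℕ) i → f i ≤ sum f
term≤sum {suc n} f i = ≤-trans (m≤m+n (f i) _) (≤-reflexive (sym (sum-remove {i = i} f)))

two-terms≤sum : ∀ {n} (f : Fin n → ℕ) {i j} → i ≢ j → f i + f j ≤ sum f
two-terms≤sum {suc n} f {i} {j} i≢j = begin
  f i + f j                              ≡⟨ cong (λ k → f i + f k) (punchIn-punchOut i≢j) ⟨
  f i + f (punchIn i (punchOut i≢j))     ≤⟨ +-monoʳ-≤ (f i) (term≤sum (f ∘ punchIn i) (punchOut i≢j)) ⟩
  f i + sum (f ∘ punchIn i)              ≡⟨ sum-remove {i = i} f ⟨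
  sum f                                  ∎
  where open ≤-Reasoning

if-does-cong : ∀ {A : Set} (A? : Dec A) {x y : ℕ} → (A → x ≡ y) →
               (if does A? then x else 0) ≡ (if does A? then y else 0)
if-does-cong (yes a) x≡y = x≡y a
if-does-cong (no _)  _   = refl

sum-delta : ∀ {n} (i : Fin n) (t : Fin n → ℕ) → sum (λ j → if does (i ≟ j) then t j else 0) ≡ t i
sum-delta {suc n} i t = begin
  sum f                        ≡⟨ sum-remove {i = i} f ⟩
  f i + sum (f ∘ punchIn i)    ≡⟨ cong₂ _+_ at-i (sum-zero off-i) ⟩
  t i + 0                      ≡⟨ +-identityʳ (t i) ⟩
  t i                          ∎
  where
  open ≡-Reasoning
  f : Fin (suc n) → ℕ
  f j = if does (i ≟ j) then t j else 0
  at-i : f i ≡ t i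
  at-i with i ≟ i
  ... | yes _   = refl
  ... | no  i≢i = contradiction refl i≢i
  off-i : ∀ j → f (punchIn i j) ≡ 0
  off-i j with i ≟ punchIn i j
  ... | yes i≡ = contradiction (sym i≡) (punchInᵢ≢i i j)
  ... | no  _  = refl

module _ {n : ℕ} {S : Pred (Fin n) 0ℓ} where

  -- For the predicate `ι i ⪰ ι j` this unfolds to `∑⪰ j`, so these lemmas apply to subtree sums
  -- without conversion.
  ∑∈ : Decidable S → (Fin n → ℕ) → ℕ
  ∑∈ S? t = sum (λ i → if does (S? i) then t i else 0)

  ∑∈-distrib-+ : ∀ (S? : Decidable S) t t′ → ∑∈ S? (λ i → t i + t′ i) ≡ ∑∈ S? t + ∑∈ S? t′
  ∑∈-distrib-+ S? t t′ = trans
    (sum-cong-≗ λ i → term (does (S? i)) (t i) (t′ i))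
    (∑-distrib-+ (λ i → if does (S? i) then t i else 0) _)
    where
    term : ∀ b x y → (if b then x + y else 0) ≡ (if b then x else 0) + (if b then y else 0)
    term true  x y = refl
    term false x y = refl

  ∑∈-cong : ∀ (S? : Decidable S) {t t′} → t ≗ t′ → ∑∈ S? t ≡ ∑∈ S? t′
  ∑∈-cong S? t≗t′ = sum-cong-≗ λ i → cong (if does (S? i) then_else 0) (t≗t′ i)

  ∑∈≤sum : ∀ (S? : Decidable S) t → ∑∈ S? t ≤ sum t
  ∑∈≤sum S? t = sum-mono-≤ λ i → term (does (S? i)) (t i)
    where
    term : ∀ b x → (if b then x else 0) ≤ x
    term true  x = ≤-refl
    term false x = z≤n

  ∑∈-delta : ∀ (S? : Decidable S) i c →
             ∑∈ S? (λ j → if does (i ≟ j) then c else 0) ≡ (if does (S? i) then c else 0)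
  ∑∈-delta S? i c = trans
    (sum-cong-≗ λ j → if-swap (does (S? j)) (does (i ≟ j)))
    (sum-delta i λ j → if does (S? j) then c else 0)
    where
    if-swap : ∀ b b′ → (if b then (if b′ then c else 0) else 0) ≡
                       (if b′ then (if b then c else 0) else 0)
    if-swap true  true  = refl
    if-swap true  false = refl
    if-swap false true  = refl
    if-swap false false = refl

-- Forbidden sets and recurrence

module ForbiddenSets {m : ℕ} (G : Multigraph (suc m)) (conn : Connected G) (s : Fin (suc m)) where

  open Multigraph G
  open Sandpile G conn s

  -- Stated positively: every inhabited decidable set yields an explicit vertex with enough chips.
  NoForbiddenSet : Config → Set₁
  NoForbiddenSet u = ∀ {S : Pred V₀ 0ℓ} (S? : Decidable S) → ∃ S →
                     ∃[ v ] S v × ∑∈ S? (λ i → e (ι i) (ι v)) ≤ u v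

  noForbidden-resp : ∀ {u v} → u ≗ v → NoForbiddenSet u → NoForbiddenSet v
  noForbidden-resp u≗v nf S? S≢∅ =
    let x , x∈S , bound = nf S? S≢∅ in x , x∈S , ≤-trans bound (≤-reflexive (u≗v x))

  -- If `S` has a member other than `i`, a witness for `S` without `i` still works: toppling `i`
  -- gives it `e (ι i) (ι v)` chips, exactly the edges that `i` adds to the count. If `S` is just
  -- `i`, only loops count, and their chips return to `i`.
  noForbidden-topple : ∀ {u} i → NoForbiddenSet u → NoForbiddenSet (topple u i)
  noForbidden-topple {u} i nf {S} S? (x , x∈S) with any? (λ k → S? k ×-dec ¬? (i ≟ k))
  ... | yes S∖i≢∅ =
    let v , (v∈S , i≢v) , bound = nf (λ k → S? k ×-dec ¬? (i ≟ k)) S∖i≢∅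
    in v , v∈S , (begin
      ∑∈ S? (λ k → e (ι k) (ι v))  ≤⟨ split (λ k → e (ι k) (ι v)) ⟩
      ∑∈ (λ k → S? k ×-dec ¬? (i ≟ k)) (λ k → e (ι k) (ι v)) + e (ι i) (ι v)
                                   ≤⟨ +-monoˡ-≤ _ bound ⟩
      u v + e (ι i) (ι v)          ≡⟨ topple-other u i≢v ⟨
      topple u i v                 ∎)
    where
    open ≤-Reasoning
    split : ∀ t → ∑∈ S? t ≤ ∑∈ (λ k → S? k ×-dec ¬? (i ≟ k)) t + t i
    split t = ≤-trans (sum-mono-≤ term) (≤-reflexive
      (trans (∑-distrib-+ (λ k → if does (S? k ×-dec ¬? (i ≟ k)) then t k else 0)
                          (λ k → if does (i ≟ k) then t k else 0))
             (cong₂ _+_ {∑∈ (λ k → S? k ×-dec ¬? (i ≟ k)) t} refl (sum-delta i t))))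
      where
      term : ∀ k → (if does (S? k) then t k else 0) ≤
                   (if does (S? k ×-dec ¬? (i ≟ k)) then t k else 0) +
                   (if does (i ≟ k) then t k else 0)
      term k with S? k | i ≟ k
      ... | no _  | _        = z≤n
      ... | yes _ | no _     = ≤-reflexive (sym (+-identityʳ _))
      ... | yes _ | yes refl = ≤-refl
  ... | no S∖i≡∅ = i , i∈S , (begin
      ∑∈ S? (λ k → e (ι k) (ι i))                            ≤⟨ sum-mono-≤ term ⟩
      sum (λ k → if does (i ≟ k) then e (ι i) (ι i) else 0)  ≡⟨ sum-delta i (λ _ → e (ι i) (ι i)) ⟩
      e (ι i) (ι i)                                          ≤⟨ m≤n+m _ _ ⟩
      (u i ∸ deg (ι i)) + e (ι i) (ι i)                      ≡⟨ topple-self u i ⟨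
      topple u i i                                           ∎)
    where
    open ≤-Reasoning
    i∈S : S i
    i∈S with i ≟ x
    ... | yes refl = x∈S
    ... | no i≢x   = contradiction (x , x∈S , i≢x) S∖i≡∅
    term : ∀ k → (if does (S? k) then e (ι k) (ι i) else 0) ≤
                 (if does (i ≟ k) then e (ι i) (ι i) else 0)
    term k with S? k | i ≟ k
    ... | no _    | _        = z≤n
    ... | yes _   | yes refl = ≤-refl
    ... | yes k∈S | no i≢k   = contradiction (k , k∈S , i≢k) S∖i≡∅

  noForbidden-⟶* : ∀ {u v} → u ⟶* v → NoForbiddenSet u → NoForbiddenSet v
  noForbidden-⟶* (done u≗v)   nf = noForbidden-resp u≗v nf
  noForbidden-⟶* (step i _ r) nf = noForbidden-⟶* r (noForbidden-topple i nf)

  noForbidden-deg≤ : ∀ {u} → (∀ i → Unstable u i) → NoForbiddenSet u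
  noForbidden-deg≤ {u} deg≤u S? (v , v∈S) = v , v∈S , (begin
    ∑∈ S? (λ i → e (ι i) (ι v))  ≤⟨ ∑∈≤sum S? _ ⟩
    sum (λ i → e (ι i) (ι v))    ≡⟨ sum-cong-≗ (λ i → e-sym (ι i) (ι v)) ⟩
    sum (e (ι v) ∘ ι)            ≤⟨ sum-remove-≤ (e (ι v)) s ⟩
    deg (ι v)                    ≤⟨ deg≤u v ⟩
    u v                          ∎)
    where open ≤-Reasoning

  -- Recurrence lets `u` be reached from a configuration dominating `deg`, where every vertex of a
  -- set is a witness.
  recurrent⇒noForbidden : ∀ {u} → Recurrent u → NoForbiddenSet u
  recurrent⇒noForbidden ru =
    let v , eq = ru (deg ∘ ι)
    in noForbidden-resp eq (noForbidden-⟶* (⟶*-σ _) (noForbidden-deg≤ λ i → m≤m+n _ (v i)))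

  recurrent⇒stable : ∀ {u} → Recurrent u → Stable u
  recurrent⇒stable ru i =
    let v , eq = ru (deg ∘ ι) in subst (_< deg (ι i)) (eq i) (σ-stable ((deg ∘ ι) ⊞ v) i)

  recurrent-resp : ∀ {u v} → u ≗ v → Recurrent u → Recurrent v
  recurrent-resp u≗v ru x = let y , eq = ru x in y , ≗-trans eq u≗v

-- The tree order and the edges leaving a subtree

vertices-head : ∀ {n} {R : Fin n → Fin n → Set} {i j} (w : Star R i j) →
                ∃[ l ] vertices w ≡ i ∷ l
vertices-head ε       = _ , refl
vertices-head (_ ◅ _) = _ , refl

vertices-next : ∀ {n} {R : Fin n → Fin n → Set} {i j} (w : Star R i j) (i≢j : i ≢ j) →
                Σ[ w′ ∈ Star R (next w i≢j) j ] vertices w ≡ i ∷ vertices w′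
vertices-next ε       i≢i = contradiction refl i≢i
vertices-next (_ ◅ w) _   = w , refl

simplify-Adj⁺ : ∀ {n} (G : Multigraph n) {i j} → i ≢ j →
                Multigraph.Adj G i j → Multigraph.Adj (simplify G) i j
simplify-Adj⁺ G {i} {j} i≢j a with i ≟ j
... | yes i≡j = contradiction i≡j i≢j
... | no _    = ⊓-glb ≤-refl a

simplify-irrefl : ∀ {n} (G : Multigraph n) {i j} →
                  Multigraph.Adj (simplify G) i j → i ≢ j
simplify-irrefl G {i} {j} a with i ≟ j
... | no i≢j = i≢j

module RootedTree {m : ℕ} (T : ThickTree (suc m)) (s : Fin (suc m)) where

  open Rooted T s
  open DecMembership (_≟_ {suc m}) using (_∈?_)

  private
    V = Fin (suc m)
    Adj′ = Multigraph.Adj T′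

  path : V → List V
  path i = vertices (walk (toSink i))

  path-injective : ∀ {i j} → path i ≡ path j → i ≡ j
  path-injective {i} {j} eq =
    let _ , eᵢ = vertices-head (walk (toSink i))
        _ , eⱼ = vertices-head (walk (toSink j))
    in ∷-injectiveˡ (trans (sym eᵢ) (trans eq eⱼ))

  -- The part of a path from `k` onwards is again a path to the sink, hence the chosen one by
  -- uniqueness.
  path-suffix : ∀ {i k} → i ⪰ k → ∃[ pre ] path i ≡ pre ++ path k
  path-suffix {i} = go (walk (toSink i)) (distinct (toSink i))
    where
    go : ∀ {i k} (w : Walk T′ i s) → Unique (vertices w) → k ∈ vertices w →
         ∃[ pre ] vertices w ≡ pre ++ path k
    go ε       u       (here refl) = [] , toSink-unique (mkPath ε u)
    go (x ◅ w) u       (here refl) = [] , toSink-unique (mkPath (x ◅ w) u)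
    go (x ◅ w) (_ ∷ u) (there k∈w) = let pre , eq = go w u k∈w in _ ∷ pre , cong (_ ∷_) eq

  ⪰-refl : ∀ {i} → i ⪰ i
  ⪰-refl {i} = Paths.start∈ T′ (walk (toSink i))

  ⪰-trans : ∀ {i j k} → i ⪰ j → j ⪰ k → i ⪰ k
  ⪰-trans i⪰j j⪰k = let pre , eq = path-suffix i⪰j in subst (_ ∈_) (sym eq) (∈-++⁺ʳ pre j⪰k)

  ⪰-antisym : ∀ {i j} → i ⪰ j → j ⪰ i → i ≡ j
  ⪰-antisym {i} {j} i⪰j j⪰i with path-suffix i⪰j | path-suffix j⪰i
  ... | []      , eq | _        = path-injective eq
  -- Each path is a suffix of the other, so a nonempty prefix contradicts the lengths.
  ... | v ∷ pre , eq | pre′ , eq′ = contradiction lengths (<⇒≱ longer)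
    where
    longer : length (path j) < length (path i)
    longer = ≤-trans (s≤s (m≤n+m _ (length pre)))
      (≤-reflexive (sym (trans (cong length eq) (cong suc (length-++ pre)))))
    lengths : length (path i) ≤ length (path j)
    lengths = ≤-trans (m≤n+m _ (length pre′))
      (≤-reflexive (sym (trans (cong length eq′) (length-++ pre′))))

  s⪰⇒≡s : ∀ {j} → s ⪰ j → j ≡ s
  s⪰⇒≡s {j} s⪰j = ⪰-antisym (Paths.end∈ T′ (walk (toSink j))) s⪰j

  -- A strict partial order on a finite set is well-founded. The orientation lets a recursion at `j`
  -- call itself on the vertices above `j`.
  ≻-wellFounded : WF.WellFounded {A = V₀} (λ i j → ι i ≻ ι j)
  ≻-wellFounded = Fin.spo-wellFounded record
    { isEquivalence = isEquivalence
    ; irrefl        = λ { refl (_ , i≢i) → i≢i refl }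
    ; trans         = λ (i⪰j , i≢j) (j⪰k , j≢k) →
        ⪰-trans i⪰j j⪰k , λ i≡k → i≢j (⪰-antisym i⪰j (subst (_ ⪰_) (sym i≡k) j⪰k))
    ; <-resp-≈      = (λ { refl i≻j → i≻j }) , (λ { refl i≻j → i≻j })
    }

  path-cons : ∀ {i x} → Adj′ i x → ¬ x ⪰ i → path i ≡ i ∷ path x
  path-cons {i} {x} a x⋡i =
    sym (toSink-unique (mkPath (a ◅ walk (toSink x)) (¬Any⇒All¬ _ x⋡i ∷ distinct (toSink x))))

  path-p : ∀ j → path (ι j) ≡ ι j ∷ path (p j)
  path-p j with vertices-next (walk (toSink (ι j))) (punchInᵢ≢i s j)
  ... | w′ , eq with subst Unique eq (distinct (toSink (ι j)))
  ...   | _ ∷ u = trans eq (cong (ι j ∷_) (toSink-unique (mkPath w′ u)))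

  ⪰p : ∀ j → ι j ⪰ p j
  ⪰p j = subst (p j ∈_) (sym (path-p j)) (there ⪰-refl)

  -- Prepending `ι j` to the path of `x` gives a path to the sink, so `x` and `p j` are both the
  -- second vertex of the unique path from `ι j`.
  p-unique : ∀ {j x} → Adj′ (ι j) x → ¬ x ⪰ ι j → x ≡ p j
  p-unique {j} a x⋡j = path-injective (∷-injectiveʳ (trans (sym (path-cons a x⋡j)) (path-p j)))

  p⋡ : ∀ j → ¬ p j ⪰ ι j
  p⋡ j pj⪰j = simplify-irrefl graph (p-Adj j) (⪰-antisym (⪰p j) pj⪰j)

  -- Of two adjacent vertices, one directly follows the other on its path to the sink. As `ι j` lies
  -- on the path of `x` but not on that of `i`, the former is `x` followed by the latter, and `ι j`
  -- can only be its head.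
  cut : ∀ {j i x} → Adj i x → x ⪰ ι j → ¬ i ⪰ ι j → x ≡ ι j × i ≡ p j
  cut {j} {i} {x} a x⪰j i⋡j = x≡j , p-unique (subst (λ y → Adj′ y i) x≡j xi) i⋡j
    where
    i≢x : i ≢ x
    i≢x refl = i⋡j x⪰j
    xi : Adj′ x i
    xi = simplify-Adj⁺ graph (i≢x ∘ sym) (Adj-sym a)
    x≡j : x ≡ ι j
    x≡j with i ∈? path x | x ∈? path i
    ... | _       | yes i⪰x = contradiction (⪰-trans i⪰x x⪰j) i⋡j
    ... | no  x⋡i | _ = contradiction
      (subst (ι j ∈_) (sym (path-cons (Multigraph.Adj-sym T′ xi) x⋡i)) (there x⪰j)) i⋡j
    ... | yes x⪰i | no i⋡x with subst (ι j ∈_) (path-cons xi i⋡x) x⪰j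
    ...   | here j≡x  = sym j≡x
    ...   | there i⪰j = contradiction i⪰j i⋡j

-- Congruences, products of cyclic groups and unordered edges

module Mod (k : ℕ) where

  open AbelianGroup (ℤ/ k) using (_≈_)

  ≡⇒≈ : ∀ {a b} → a ≡ b → a ≈ b
  ≡⇒≈ {a} refl = AbelianGroup.refl (ℤ/ k) {a}

  sum-≈ : ∀ {n} (f g : Fin n → ℕ) → (∀ i → + f i ≈ + g i) → + sum f ≈ + sum g
  sum-≈ {zero}  f g f≈g = ≡⇒≈ {+ 0} refl
  sum-≈ {suc n} f g f≈g = subst (+ k ∣_) (regroup (+ f zero) (+ g zero) (+ sum (f ∘ suc)) (+ sum (g ∘ suc)))
    (∣m∣n⇒∣m+n (f≈g zero) (sum-≈ (f ∘ suc) (g ∘ suc) (f≈g ∘ suc)))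
    where
    regroup : ∀ a b c d → (a ℤ.- b) ℤ.+ (c ℤ.- d) ≡ (a ℤ.+ c) ℤ.- (b ℤ.+ d)
    regroup = solve-∀

  balance-≈ : ∀ a b x y → a + x ≡ b + y → + x ≈ + y → + b ≈ + a
  balance-≈ a b x y eq = subst (+ k ∣_) (begin
    + x ℤ.- + y                          ≡⟨ shuffle₁ (+ a) (+ x) (+ y) ⟩
    (+ a ℤ.+ + x) ℤ.- (+ a ℤ.+ + y)      ≡⟨ cong (ℤ._- (+ a ℤ.+ + y)) (cong +_ eq) ⟩
    (+ b ℤ.+ + y) ℤ.- (+ a ℤ.+ + y)      ≡⟨ shuffle₂ (+ a) (+ b) (+ y) ⟩
    + b ℤ.- + a                          ∎)
    where
    open ≡-Reasoning
    shuffle₁ : ∀ a x y → x ℤ.- y ≡ (a ℤ.+ x) ℤ.- (a ℤ.+ y)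
    shuffle₁ = solve-∀
    shuffle₂ : ∀ a b y → (b ℤ.+ y) ℤ.- (a ℤ.+ y) ≡ b ℤ.- a
    shuffle₂ = solve-∀

-- Every factor has carrier ℤ whatever its modulus, so coordinates are permuted without transport
-- and only the congruences are rewritten along `k≡l`.
∏ℤ-reindex : ∀ {m} {k l : Fin m → ℕ} (π : Permutation′ m) → (∀ j → k j ≡ l (π ⟨$⟩ʳ j)) →
             ∏ (λ j → ℤ/ k j) ≅ ∏ (λ j → ℤ/ l j)
∏ℤ-reindex {m} {k} {l} π k≡l = (λ v j → v (π ⟨$⟩ˡ j)) , isIsomorphism A B (λ v j → v (π ⟨$⟩ˡ j))
  (λ u≈v j → subst (λ n → + n ∣ _) (k≡l′ j) (u≈v (π ⟨$⟩ˡ j)))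
  (λ u v → B.refl {λ j → u (π ⟨$⟩ˡ j) ℤ.+ v (π ⟨$⟩ˡ j)})
  (λ {u} {v} u≈v j → subst₂ (λ n i → + n ∣ u i ℤ.- v i) (sym (k≡l j)) (inverseˡ π)
    (u≈v (π ⟨$⟩ʳ j)))
  (λ v → (λ j → v (π ⟨$⟩ʳ j)) , λ j →
    Mod.≡⇒≈ (l j) {v (π ⟨$⟩ʳ (π ⟨$⟩ˡ j))} (cong v (inverseʳ π)))
  where
  A = ∏ (λ j → ℤ/ k j)
  B = ∏ (λ j → ℤ/ l j)
  module B = AbelianGroup B
  k≡l′ : ∀ j → k (π ⟨$⟩ˡ j) ≡ l j
  k≡l′ j = trans (k≡l (π ⟨$⟩ˡ j)) (cong l (inverseʳ π))

SameEdge : ∀ {n} → (a b c d : Fin n) → Set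
SameEdge a b c d = (a ≡ c × b ≡ d) ⊎ (a ≡ d × b ≡ c)

sameEdge-trans : ∀ {n} {a b c d x y : Fin n} → SameEdge a b c d → SameEdge c d x y → SameEdge a b x y
sameEdge-trans (inj₁ (refl , refl)) cdxy                 = cdxy
sameEdge-trans (inj₂ (refl , refl)) (inj₁ (refl , refl)) = inj₂ (refl , refl)
sameEdge-trans (inj₂ (refl , refl)) (inj₂ (refl , refl)) = inj₁ (refl , refl)

-- Subtree sums modulo edge multiplicities

module RootedSandpile {m : ℕ} (T : ThickTree (suc m)) (s : Fin (suc m)) where

  open Rooted T s
  open RootedTree T s
  open ForbiddenSets graph connected s

  private
    module G = AbelianGroup sandpileGroup
    module P = AbelianGroup ∏ℤ/w
    Adj′ = Multigraph.Adj T′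

  ι⪰? : ∀ j i → Dec (ι i ⪰ ι j)
  ι⪰? j i = ι i ⪰? ι j

  infix 4 _≈[_]_
  _≈[_]_ : ℤ → V₀ → ℤ → Set
  a ≈[ j ] b = AbelianGroup._≈_ (ℤ/ w j) a b

  -- So a multiplicity across the boundary of the subtree above `j` is 0 or `w j`, and vanishes
  -- modulo `w j` either way.
  e-cut : ∀ {i j x} → x ⪰ ι j → ¬ i ⪰ ι j → 0 < e i x → e i x ≡ w j
  e-cut x⪰j i⋡j a with cut a x⪰j i⋡j
  ... | refl , refl = e-sym _ _

  -- The sink lies in no subtree above a non-sink vertex, so its term drops out.
  sum-inside : ∀ y j → sum (λ x → if does (x ⪰? ι j) then e y x else 0) ≡ ∑⪰ j (e y ∘ ι)
  sum-inside y j = sum-remove-zero (λ x → if does (x ⪰? ι j) then e y x else 0) s at-s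
    where
    at-s : (if does (s ⪰? ι j) then e y s else 0) ≡ 0
    at-s with s ⪰? ι j
    ... | yes s⪰j = contradiction (s⪰⇒≡s s⪰j) (punchInᵢ≢i s j)
    ... | no _    = refl

  -- When `i` topples, the left side is what the subtree above `j` gives away and the right side
  -- what it receives. Edge by edge, the two agree unless the edge crosses the boundary, where
  -- `e-cut` applies.
  deg≈∑⪰e : ∀ i j → + (if does (ι⪰? j i) then deg (ι i) else 0) ≈[ j ] + ∑⪰ j (e (ι i) ∘ ι)
  deg≈∑⪰e i j = subst₂ (λ a b → + a ≈[ j ] + b) lhs (sum-inside (ι i) j) (sum-≈ row inside term)
    where
    open Mod (w j)
    row inside : Fin (suc m) → ℕ
    row x = if does (ι⪰? j i) then e (ι i) x else 0
    inside x = if does (x ⪰? ι j) then e (ι i) x else 0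
    lhs : sum row ≡ (if does (ι⪰? j i) then deg (ι i) else 0)
    lhs with ι⪰? j i
    ... | yes _ = refl
    ... | no  _ = sum-replicate-zero (suc m)
    w∣0 : ∀ a → a ≡ 0 ⊎ a ≡ w j → + a ≈[ j ] + 0
    w∣0 _ (inj₁ refl) = ≡⇒≈ {+ 0} refl
    w∣0 _ (inj₂ refl) = subst (+ w j ∣_) (sym (ℤ.+-identityʳ _)) ∣-refl
    zero-or : ∀ {a b} → (0 < a → a ≡ b) → a ≡ 0 ⊎ a ≡ b
    zero-or {zero}  _  = inj₁ refl
    zero-or {suc a} eq = inj₂ (eq z<s)
    term : ∀ x → + row x ≈[ j ] + inside x
    term x with ι⪰? j i | x ⪰? ι j
    ... | yes _   | yes _   = ≡⇒≈ {+ e (ι i) x} refl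
    ... | no _    | no _    = ≡⇒≈ {+ 0} refl
    ... | no i⋡j  | yes x⪰j = AbelianGroup.sym (ℤ/ w j) {+ e (ι i) x} {+ 0}
      (w∣0 (e (ι i) x) (zero-or (e-cut x⪰j i⋡j)))
    ... | yes i⪰j | no x⋡j  = w∣0 (e (ι i) x) (zero-or λ a →
      trans (e-sym (ι i) x) (e-cut i⪰j x⋡j (Adj-sym a)))

  -- Adding the chips removed from `i` back turns the toppling into an equation in ℕ, free of
  -- truncated subtraction.
  ∑⪰-topple : ∀ {u} i → Unstable u i → ∀ j → + ∑⪰ j u ≈[ j ] + ∑⪰ j (topple u i)
  ∑⪰-topple {u} i un j = Mod.balance-≈ (w j) (∑⪰ j (topple u i)) (∑⪰ j u) _ _ (begin
    ∑⪰ j (topple u i) + (if does (ι⪰? j i) then deg (ι i) else 0)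
      ≡⟨ cong₂ _+_ {∑⪰ j (topple u i)} refl (∑∈-delta (ι⪰? j) i (deg (ι i))) ⟨
    ∑⪰ j (topple u i) + ∑⪰ j δ                ≡⟨ ∑∈-distrib-+ (ι⪰? j) (topple u i) δ ⟨
    ∑⪰ j (topple u i ⊞ δ)                     ≡⟨ ∑∈-cong (ι⪰? j) (topple-balance u i un) ⟩
    ∑⪰ j (u ⊞ (e (ι i) ∘ ι))                  ≡⟨ ∑∈-distrib-+ (ι⪰? j) u _ ⟩
    ∑⪰ j u + ∑⪰ j (e (ι i) ∘ ι)               ∎) (deg≈∑⪰e i j)
    where
    open ≡-Reasoning
    δ : Config
    δ k = if does (i ≟ k) then deg (ι i) else 0

  ∑⪰-cong : ∀ {u v} → u ≗ v → ∀ j → + ∑⪰ j u ≈[ j ] + ∑⪰ j v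
  ∑⪰-cong {u} u≗v j = Mod.≡⇒≈ (w j) {+ ∑⪰ j u} (cong +_ (∑∈-cong (ι⪰? j) u≗v))

  ∑⪰-⟶* : ∀ {u v} → u ⟶* v → ∀ j → + ∑⪰ j u ≈[ j ] + ∑⪰ j v
  ∑⪰-⟶* (done u≗v) j = ∑⪰-cong u≗v j
  ∑⪰-⟶* {u} {v} (step i un r) j =
    AbelianGroup.trans (ℤ/ w j) {+ ∑⪰ j u} {+ ∑⪰ j (topple u i)} {+ ∑⪰ j v}
      (∑⪰-topple i un j) (∑⪰-⟶* r j)

  ∑⪰-⊕ : ∀ u v j → + ∑⪰ j (u ⊕ v) ≈[ j ] + ∑⪰ j u ℤ.+ + ∑⪰ j v
  ∑⪰-⊕ u v j = AbelianGroup.sym (ℤ/ w j) {+ ∑⪰ j u ℤ.+ + ∑⪰ j v} {+ ∑⪰ j (u ⊕ v)}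
    (subst (_≈[ j ] + ∑⪰ j (u ⊕ v)) (cong +_ (∑∈-distrib-+ (ι⪰? j) u v)) (∑⪰-⟶* (⟶*-σ (u ⊞ v)) j))

  -- Recurrent configurations lie in the box

  -- By `cut`, an edge at `y` that leaves the subtree above `j` exists only for `y ≡ ι j`, and then
  -- ends at `p j`.
  outflow : ∀ {y j} → y ⪰ ι j → deg y ≤ ∑⪰ j (e y ∘ ι) + (if does (y ≟ ι j) then w j else 0)
  outflow {y} {j} y⪰j = begin
    deg y                          ≤⟨ sum-mono-≤ term ⟩
    sum (λ x → inside x + at-p x)  ≡⟨ ∑-distrib-+ inside at-p ⟩
    sum inside + sum at-p          ≡⟨ cong₂ _+_ (sum-inside y j) (sum-delta (p j) (λ _ → spill)) ⟩
    ∑⪰ j (e y ∘ ι) + spill         ∎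
    where
    open ≤-Reasoning
    spill : ℕ
    spill = if does (y ≟ ι j) then w j else 0
    inside at-p : Fin (suc m) → ℕ
    inside x = if does (x ⪰? ι j) then e y x else 0
    at-p x = if does (p j ≟ x) then spill else 0
    escape : ∀ {x} → ¬ x ⪰ ι j → e y x ≤ at-p x
    escape {x} x⋡j with e y x in eq
    ... | zero  = z≤n
    ... | suc n with cut (Adj-sym (subst (0 <_) (sym eq) z<s)) y⪰j x⋡j
    ...   | refl , refl with p j ≟ p j | y ≟ y
    ...     | yes _  | yes _  = ≤-reflexive (sym eq)
    ...     | no p≢p | _      = contradiction refl p≢p
    ...     | yes _  | no y≢y = contradiction refl y≢y
    term : ∀ x → e y x ≤ inside x + at-p x
    term x with x ⪰? ι j
    ... | yes _  = m≤m+n _ _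
    ... | no x⋡j = escape x⋡j

  Box : Config → Set
  Box u = ∀ j → deg (ι j) > u j × u j ≥ deg (ι j) ∸ w j

  recurrent⇒box : ∀ {u} → Recurrent u → Box u
  recurrent⇒box {u} ru j = stable j , lower
    where
    stable : Stable u
    stable = recurrent⇒stable ru
    lower : u j ≥ deg (ι j) ∸ w j
    lower with recurrent⇒noForbidden ru (ι⪰? j) (j , ⪰-refl)
    ... | v , v⪰j , bound = go (ι v ≟ ι j) (≤-trans (outflow v⪰j) (+-monoˡ-≤ _ bound′))
      where
      bound′ : ∑⪰ j (e (ι v) ∘ ι) ≤ u v
      bound′ = subst (_≤ u v) (∑∈-cong (ι⪰? j) λ i → e-sym (ι i) (ι v)) bound
      go : (v≟j : Dec (ι v ≡ ι j)) → deg (ι v) ≤ u v + (if does v≟j then w j else 0) →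
           u j ≥ deg (ι j) ∸ w j
      go (yes v≡j) deg≤ with punchIn-injective s v j v≡j
      ... | refl = m≤n+o⇒m∸n≤o (deg (ι j)) (w j) (≤-trans deg≤ (≤-reflexive (+-comm (u j) (w j))))
      -- A witness other than `j` has all its edges inside the subtree, hence at least `deg` chips,
      -- against stability.
      go (no _)    deg≤ = contradiction (subst (deg (ι v) ≤_) (+-identityʳ (u v)) deg≤) (<⇒≱ (stable v))

  ∑⪰≡+∑≻ : ∀ j u → ∑⪰ j u ≡ u j + ∑≻ j u
  ∑⪰≡+∑≻ j u = begin
    ∑⪰ j u                                   ≡⟨ sum-cong-≗ term ⟩
    sum (λ i → at-j i + above i)             ≡⟨ ∑-distrib-+ at-j above ⟩
    sum at-j + ∑≻ j u                        ≡⟨ cong (_+ ∑≻ j u) (sum-delta j (λ _ → u j)) ⟩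
    u j + ∑≻ j u                             ∎
    where
    open ≡-Reasoning
    at-j above : Config
    at-j i = if does (j ≟ i) then u j else 0
    above i = if does (ι i ≻? ι j) then u i else 0
    term : ∀ i → (if does (ι i ⪰? ι j) then u i else 0) ≡ at-j i + above i
    term i with j ≟ i
    term i | yes refl with ι i ⪰? ι i | ι i ≟ ι i
    ... | yes _  | yes _  = sym (+-identityʳ (u i))
    ... | yes _  | no i≢i = contradiction refl i≢i
    ... | no i⋡i | _      = contradiction ⪰-refl i⋡i
    term i | no j≢i with ι i ⪰? ι j | ι i ≟ ι j
    ... | no _  | _       = refl
    ... | yes _ | no _    = refl
    ... | yes _ | yes i≡j = contradiction (sym (punchIn-injective s i j i≡j)) j≢i

  -- The recursion from the leaves to the sink

  -- Encodes two conditions at once: since `f j` takes its values in the box and fixes the residue,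
  -- solving means lying in the box with subtree sums congruent to `v`. The next lemmas prove both
  -- directions.
  Solves : P.Carrier → Config → Set
  Solves v u = ∀ j → u j ≡ f j (v j ℤ.- + ∑≻ j u)

  private
    ∑⪰-minus : ∀ j u a → + u j ℤ.- (a ℤ.- + ∑≻ j u) ≡ + ∑⪰ j u ℤ.- a
    ∑⪰-minus j u a = begin
      + u j ℤ.- (a ℤ.- + ∑≻ j u)      ≡⟨ regroup (+ u j) a (+ ∑≻ j u) ⟩
      (+ u j ℤ.+ + ∑≻ j u) ℤ.- a      ≡⟨ cong (λ n → + n ℤ.- a) (∑⪰≡+∑≻ j u) ⟨
      + ∑⪰ j u ℤ.- a                  ∎
      where
      open ≡-Reasoning
      regroup : ∀ x a y → x ℤ.- (a ℤ.- y) ≡ (x ℤ.+ y) ℤ.- a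
      regroup = solve-∀

  solves : ∀ v {u} → Box u → (∀ j → + ∑⪰ j u ≈[ j ] v j) → Solves v u
  solves v {u} box φu≈v j = f-unique j (v j ℤ.- + ∑≻ j u) (u j) (proj₂ (box j)) (proj₁ (box j))
    (subst (+ w j ∣_) (sym (∑⪰-minus j u (v j))) (φu≈v j))

  solves⇒box : ∀ v {u} → Solves v u → Box u
  solves⇒box v {u} sol j =
    subst (deg (ι j) >_) (sym (sol j)) (f-upper j (v j ℤ.- + ∑≻ j u)) ,
    subst (_≥ deg (ι j) ∸ w j) (sym (sol j)) (f-lower j (v j ℤ.- + ∑≻ j u))

  solves⇒≈ : ∀ v {u} → Solves v u → ∀ j → + ∑⪰ j u ≈[ j ] v j
  solves⇒≈ v {u} sol j = subst (+ w j ∣_)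
    (trans (cong (λ n → + n ℤ.- a) (sym (sol j))) (∑⪰-minus j u (v j))) (f-mod j a)
    where
    a : ℤ
    a = v j ℤ.- + ∑≻ j u

  -- The equation at `j` reads only values strictly above `j`, which agree by well-founded
  -- induction.
  solution-unique : ∀ v {u u′} → Solves v u → Solves v u′ → u ≗ u′
  solution-unique v {u} {u′} sol sol′ = WF.All.wfRec ≻-wellFounded 0ℓ _ λ j ih →
    trans (sol j) (trans (cong (λ n → f j (v j ℤ.- + n)) (sum-cong-≗ (term j ih))) (sym (sol′ j)))
    where
    term : ∀ j → (∀ {i} → ι i ≻ ι j → u i ≡ u′ i) → ∀ i →
           (if does (ι i ≻? ι j) then u i else 0) ≡ (if does (ι i ≻? ι j) then u′ i else 0)
    term j ih i = if-does-cong (ι i ≻? ι j) ih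

  module _ (v : P.Carrier) where

    private
      -- A conditional whose branch receives the proof: the recursive call at `i` needs evidence of
      -- `ι i ≻ ι j`.
      on-yes : ∀ {A : Set} → Dec A → (A → ℕ) → ℕ
      on-yes (yes a) t = t a
      on-yes (no _)  _ = 0

      on-yes-const : ∀ {A : Set} (A? : Dec A) n → on-yes A? (λ _ → n) ≡ (if does A? then n else 0)
      on-yes-const (yes _) n = refl
      on-yes-const (no _)  n = refl

      on-yes-cong : ∀ {A : Set} (A? : Dec A) {t t′ : A → ℕ} →
                    (∀ a → t a ≡ t′ a) → on-yes A? t ≡ on-yes A? t′
      on-yes-cong (yes a) t≗t′ = t≗t′ a
      on-yes-cong (no _)  _    = refl

      body : ∀ j → (∀ {i} → ι i ≻ ι j → ℕ) → ℕ
      body j rec = f j (v j ℤ.- + sum λ i → on-yes (ι i ≻? ι j) rec)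

    solution : Config
    solution = WF.All.wfRec ≻-wellFounded 0ℓ (λ _ → ℕ) body

    solution-solves : Solves v solution
    solution-solves j = trans
      -- Unfolding the fixed point requires that `body` respect pointwise equality of the recursive
      -- values.
      (WF.FixPoint.unfold-wfRec ≻-wellFounded (λ _ → ℕ) body
        (λ j ih → cong (λ n → f j (v j ℤ.- + n))
          (sum-cong-≗ λ i → on-yes-cong (ι i ≻? ι j) λ i≻j → ih i≻j)))
      (cong (λ n → f j (v j ℤ.- + n)) (sum-cong-≗ λ i → on-yes-const (ι i ≻? ι j) (solution i)))

  -- The box is recurrent and `φ` is an isomorphism

  -- `unit ⊕ unit` is `unit`, so its subtree sum is idempotent modulo `w j`. This comes straight
  -- from `∑⪰-⊕`, since surjectivity of `φ` will rest on it.
  ∑⪰-unit : ∀ j → + ∑⪰ j (proj₁ G.ε) ≈[ j ] + 0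
  ∑⪰-unit j = identityˡ-unique (+ ∑⪰ j unit) (+ ∑⪰ j unit)
    (≈.trans {+ ∑⪰ j unit ℤ.+ + ∑⪰ j unit} {+ ∑⪰ j (unit ⊕ unit)} {+ ∑⪰ j unit}
      (≈.sym {+ ∑⪰ j (unit ⊕ unit)} {+ ∑⪰ j unit ℤ.+ + ∑⪰ j unit} (∑⪰-⊕ unit unit j))
      (∑⪰-cong (G.identityˡ G.ε) j))
    where
    module ≈ = AbelianGroup (ℤ/ w j)
    open GroupProperties ≈.group using (identityˡ-unique)
    unit : Config
    unit = proj₁ G.ε

  box⇒recurrent : ∀ {u} → Box u → Recurrent u
  box⇒recurrent {u} box = recurrent-resp
    (solution-unique φu
      (solves φu (recurrent⇒box u⊕unit-recurrent) u⊕unit≈u)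
      (solves φu box (λ j → Mod.≡⇒≈ (w j) {+ ∑⪰ j u} refl)))
    u⊕unit-recurrent
    where
    φu : P.Carrier
    φu j = + ∑⪰ j u
    unit : Config
    unit = proj₁ G.ε
    u⊕unit-recurrent : Recurrent (u ⊕ unit)
    -- A sum is recurrent as soon as one summand is, here `unit`.
    u⊕unit-recurrent v = let x , eq = recurrent-⊕ u (proj₂ G.ε) v in x , ≗-trans eq (⊕-comm unit u)
    u⊕unit≈u : ∀ j → + ∑⪰ j (u ⊕ unit) ≈[ j ] + ∑⪰ j u
    u⊕unit≈u j = ≈.trans {+ ∑⪰ j (u ⊕ unit)} {+ ∑⪰ j u ℤ.+ + ∑⪰ j unit} {+ ∑⪰ j u}
      (∑⪰-⊕ u unit j)
      (≈.trans {+ ∑⪰ j u ℤ.+ + ∑⪰ j unit} {+ ∑⪰ j u ℤ.+ + 0} {+ ∑⪰ j u}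
        (≈.∙-cong {+ ∑⪰ j u} {+ ∑⪰ j u} {+ ∑⪰ j unit} {+ 0} (≈.refl {+ ∑⪰ j u}) (∑⪰-unit j))
        (≈.identityʳ (+ ∑⪰ j u)))
      where module ≈ = AbelianGroup (ℤ/ w j)

  φ-isIsomorphism : IsIsomorphism sandpileGroup ∏ℤ/w φ
  φ-isIsomorphism = isIsomorphism sandpileGroup ∏ℤ/w φ
    (λ u≗v j → ∑⪰-cong u≗v j)
    (λ (u , _) (v , _) j → ∑⪰-⊕ u v j)
    (λ {u} {v} → injective u v)
    -- The preimage is the solution of the recursion: it lies in the box, hence in the group.
    (λ v → (solution v , box⇒recurrent (solves⇒box v (solution-solves v))) ,
           solves⇒≈ v (solution-solves v))
    where
    injective : ∀ u v → φ u P.≈ φ v → u G.≈ v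
    injective u v φu≈φv = solution-unique (φ v)
      (solves (φ v) (recurrent⇒box (proj₂ u)) φu≈φv)
      (solves (φ v) (recurrent⇒box (proj₂ v)) (P.refl {φ v}))

  -- The inverse map and its values at leaves

  rep-≈ : ∀ v j → v j ≈[ j ] + rep v j
  rep-≈ v j = divides (v j /ℕ w j) (begin
    v j ℤ.- + rep v j                                        ≡⟨ cong (ℤ._- + rep v j) (a≡a%ℕn+[a/ℕn]*n (v j) (w j)) ⟩
    (+ rep v j ℤ.+ (v j /ℕ w j) ℤ.* + w j) ℤ.- + rep v j     ≡⟨ cancel (+ rep v j) _ ⟩
    (v j /ℕ w j) ℤ.* + w j                                   ∎)
    where
    open ≡-Reasoning
    cancel : ∀ x y → (x ℤ.+ y) ℤ.- x ≡ y
    cancel = solve-∀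

  -- `c` is the vertex just before `ι j` on the path from `i`. What follows is the path of `ι j`,
  -- which cannot revisit `c`.
  child : ∀ {i j} → i ≻ ι j → ∃[ c ] Adj′ c (ι j) × ¬ ι j ⪰ c
  child {i} {j} (i⪰j , i≢j) = go (walk (toSink i)) (distinct (toSink i)) i⪰j i≢j
    where
    go : ∀ {i} (w : Walk T′ i s) → Unique (vertices w) → ι j ∈ vertices w → i ≢ ι j →
         ∃[ c ] Adj′ c (ι j) × ¬ ι j ⪰ c
    go ε       _ (here j≡i) i≢j = contradiction (sym j≡i) i≢j
    go (_ ◅ _) _ (here j≡i) i≢j = contradiction (sym j≡i) i≢j
    go {i} (_◅_ {j = a} x w) (i∉w ∷ u) (there j∈w) i≢j with a ≟ ι j
    ... | yes refl = i , x , All¬⇒¬Any i∉w ∘ subst (i ∈_) (sym (toSink-unique (mkPath w u)))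
    ... | no  a≢j  = go w u j∈w a≢j

  leaf-neighbour : ∀ {j x} → Leaf j → Adj′ (ι j) x → x ≡ p j
  leaf-neighbour {j} {x} leaf a with x ≟ p j
  ... | yes x≡p = x≡p
  ... | no  x≢p = contradiction
    (≤-trans (+-mono-≤ a (p-Adj j)) (two-terms≤sum (Multigraph.e T′ (ι j)) x≢p))
    (<⇒≱ (≤-reflexive (cong suc leaf)))

  -- A vertex above `j` would supply a neighbour off the path of `ι j`, whereas the only neighbour
  -- of a leaf is `p j`, on that path.
  leaf-maximal : ∀ {i j} → Leaf j → ¬ i ≻ ι j
  leaf-maximal {j = j} leaf i≻j =
    let c , a , j⋡c = child i≻j
    in j⋡c (subst (ι j ⪰_) (sym (leaf-neighbour leaf (Multigraph.Adj-sym T′ a))) (⪰p j))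

  leaf-∑≻ : ∀ {j} → Leaf j → ∀ u → ∑≻ j u ≡ 0
  leaf-∑≻ {j} leaf u = sum-zero λ i → term (ι i ≻? ι j) (u i)
    where
    term : ∀ {i} (i≻?j : Dec (i ≻ ι j)) n → (if does i≻?j then n else 0) ≡ 0
    term (yes i≻j) _ = contradiction i≻j (leaf-maximal leaf)
    term (no _)    _ = refl

  -- All edges at `ι j` go to `p j`, so the box at `j` starts at 0 and consists of the standard
  -- representatives.
  looplessLeaf-deg : ∀ {j} → LooplessLeaf j → deg (ι j) ≤ w j
  looplessLeaf-deg {j} (leaf , loopless) =
    ≤-trans (sum-mono-≤ term) (≤-reflexive (sum-delta (p j) (λ _ → w j)))
    where
    term : ∀ x → e (ι j) x ≤ (if does (p j ≟ x) then w j else 0)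
    term x with p j ≟ x
    ... | yes refl = ≤-refl
    ... | no  p≢x  = ≮⇒≥ λ a → p≢x (sym (leaf-neighbour leaf (simplify-Adj⁺ graph (j≢x a) a)))
      where
      j≢x : 0 < e (ι j) x → ι j ≢ x
      j≢x a refl = contradiction loopless (>⇒≢ a)

  module _ {φ⁻¹ : P.Carrier → G.Carrier} (inv : Inverseᵇ G._≈_ P._≈_ φ φ⁻¹)
           (v : P.Carrier) (j : V₀) where

    inverse-recursion : proj₁ (φ⁻¹ v) j ≡ f j (+ rep v j ℤ.- + ∑≻ j (proj₁ (φ⁻¹ v)))
    -- The representatives `rep v` name the same element of the product as `v`, so they may serve as
    -- the target of the recursion.
    inverse-recursion = solves (λ i → + rep v i) (recurrent⇒box (proj₂ (φ⁻¹ v)))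
      (P.trans {φ (φ⁻¹ v)} {v} {λ i → + rep v i} (proj₁ inv {v} {φ⁻¹ v} (G.refl {φ⁻¹ v})) (rep-≈ v)) j

    inverse-looplessLeaf : LooplessLeaf j → proj₁ (φ⁻¹ v) j ≡ rep v j
    -- Nothing lies above a leaf, so `f j` is applied to `rep v j` itself, which is already in the
    -- range of `f j`.
    inverse-looplessLeaf leaf = trans inverse-recursion (sym (f-unique j (+ rep v j ℤ.- + ∑≻ j u) (rep v j)
      (≤-trans (≤-reflexive (m≤n⇒m∸n≡0 (looplessLeaf-deg leaf))) z≤n)
      (<-≤-trans (n%ℕd<d (v j) (w j)) (w≤deg j))
      (Mod.≡⇒≈ (w j) {+ rep v j} (sym (trans
        (cong (λ n → + rep v j ℤ.- + n) (leaf-∑≻ (proj₁ leaf) u))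
        (ℤ.+-identityʳ (+ rep v j)))))))
      where
      u : Config
      u = proj₁ (φ⁻¹ v)

  -- Change of sink

  orient-below : ∀ {a b} → Adj′ a b → ¬ b ⪰ a → ∃[ k ] ι k ≡ a × p k ≡ b
  orient-below {a} {b} ab b⋡a = k , ιk≡a ,
    sym (p-unique (subst (λ y → Adj′ y b) (sym ιk≡a) ab) (subst (λ y → ¬ b ⪰ y) (sym ιk≡a) b⋡a))
    where
    -- The sink is on every path, so a vertex missing from the path of `b` has an index in `V₀`.
    s≢a : s ≢ a
    s≢a refl = b⋡a (Paths.end∈ T′ (walk (toSink b)))
    k : V₀
    k = punchOut s≢a
    ιk≡a : ι k ≡ a
    ιk≡a = punchIn-punchOut s≢a

  -- By antisymmetry one end is missing from the path of the other, and that end is the child. With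
  -- `parentEdge-injective`, this matches `V₀` with the edges of `T′`.
  orient : ∀ {a b} → Adj′ a b → ∃[ k ] SameEdge (ι k) (p k) a b
  orient {a} {b} ab with b ⪰? a
  ... | no b⋡a  = let k , eqs = orient-below ab b⋡a in k , inj₁ eqs
  ... | yes b⪰a = let k , eqs = orient-below (Multigraph.Adj-sym T′ ab) a⋡b in k , inj₂ eqs
    where
    a⋡b : ¬ a ⪰ b
    a⋡b a⪰b = simplify-irrefl graph ab (⪰-antisym a⪰b b⪰a)

  -- If the ends matched crosswise, `k` and `l` would be parents of each other.
  parentEdge-injective : ∀ {k l} → SameEdge (ι k) (p k) (ι l) (p l) → k ≡ l
  parentEdge-injective         (inj₁ (k≡l , _))     = punchIn-injective s _ _ k≡l
  parentEdge-injective {k} {l} (inj₂ (k≡pl , pk≡l)) =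
    contradiction (subst₂ _⪰_ k≡pl pk≡l (⪰p k)) (p⋡ l)

module _ {m : ℕ} (T : ThickTree (suc m)) where

  open ThickTree T
  open Multigraph graph

  private
    module At (r : Fin (suc m)) where
      open Rooted T r public using (ι; p; p-Adj; w)
      open RootedSandpile T r public using (orient; parentEdge-injective)

  -- The edge of `T′` from `j` to its parent towards `s` is kept; `k` is its child end when paths
  -- lead to `t`.
  transport : ∀ s t j → ∃[ k ] SameEdge (At.ι t k) (At.p t k) (At.ι s j) (At.p s j)
  transport s t j = At.orient t (At.p-Adj s j)

  -- Both transports preserve the edge, and for a fixed sink the edge determines its label.
  transport-inverse : ∀ s t j → proj₁ (transport t s (proj₁ (transport s t j))) ≡ j
  transport-inverse s t j = At.parentEdge-injective s
    (sameEdge-trans (proj₂ (transport t s _)) (proj₂ (transport s t j)))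

  parentEdges : ∀ s t → Permutation′ m
  parentEdges s t = permutation (proj₁ ∘ transport s t) (proj₁ ∘ transport t s)
    (transport-inverse t s) (transport-inverse s t)

  ∏ℤ/w-≅ : ∀ s t → Rooted.∏ℤ/w T s ≅ Rooted.∏ℤ/w T t
  ∏ℤ/w-≅ s t = ∏ℤ-reindex (parentEdges s t) λ j → sym (same-e (proj₂ (transport s t j)))
    where
    same-e : ∀ {a b c d} → SameEdge a b c d → e a b ≡ e c d
    same-e (inj₁ (refl , refl)) = refl
    same-e (inj₂ (refl , refl)) = e-sym _ _

  sandpileGroup-≅ : ∀ s t → Rooted.sandpileGroup T s ≅ Rooted.sandpileGroup T t
  sandpileGroup-≅ s t = ≅-trans {G s} {P s} {G t} (φ≅ s)
    (≅-trans {P s} {P t} {G t} (∏ℤ/w-≅ s t) (≅-sym {G t} {P t} (φ≅ t)))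
    where
    G P : ∀ r → AbelianGroup 0ℓ 0ℓ
    G = Rooted.sandpileGroup T
    P = Rooted.∏ℤ/w T
    φ≅ : ∀ r → G r ≅ P r
    φ≅ r = Rooted.φ T r , RootedSandpile.φ-isIsomorphism T r

theorem3p4 :
    ∀ {m : ℕ} (T : ThickTree (suc m)) (s : Fin (suc m)) →
    let open Rooted T s
        module G = AbelianGroup sandpileGroup
        module P = AbelianGroup ∏ℤ/w
    in
      (∀ (u : Config) →
         Recurrent u ⇔ (∀ j → deg (ι j) > u j × u j ≥ deg (ι j) ∸ w j))
    × (IsIsomorphism sandpileGroup ∏ℤ/w φ
       × (∀ (t : Fin (suc m)) → sandpileGroup ≅ Rooted.sandpileGroup T t))
    × (∀ (φ⁻¹ : P.Carrier → G.Carrier) → Inverseᵇ G._≈_ P._≈_ φ φ⁻¹ →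
       ∀ (v : P.Carrier) (j : V₀) →
         (LooplessLeaf j → proj₁ (φ⁻¹ v) j ≡ rep v j)
       × (¬ LooplessLeaf j →
            proj₁ (φ⁻¹ v) j ≡ f j (+ rep v j - + ∑≻ j (proj₁ (φ⁻¹ v)))))
theorem3p4 T s =
    (λ u → mk⇔ (recurrent⇒box {u}) (box⇒recurrent {u}))
  , (φ-isIsomorphism , sandpileGroup-≅ T s)
  , λ φ⁻¹ inv v j → inverse-looplessLeaf {φ⁻¹} inv v j , λ _ → inverse-recursion {φ⁻¹} inv v j
  where open RootedSandpile T s
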